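{- Let $p$ be an odd prime and let $u\in\mathbb{Z}_p$ with $u\not\equiv \frac 14\pmod p$. Then $$\sum_{n=0}^{p-1}A_nu^n \equiv\sum_{k=0}^{p-1}\binom{2k}k^2\binom{3k}k\Big(\frac{u^2}{(1-4u)^3}\Big)^k\pmod p,$$ where $A_n=\sum_{k=0}^n\binom{2k}k\binom{2n-2k}{n-k}\binom nk^2$.
   Context: For a prime $p$, $\mathbb{Z}_p$ denotes the set of rational numbers whose denominator is not divisible by $p$; congruences modulo $p$ are taken in $\mathbb{Z}_p$. -}

module Defs where

open import Data.Nat as ℕ using (ℕ; zero; suc)
open import Data.Nat.Divisibility using (_∣_)
open import Data.Nat.Combinatorics using (_C_)
open import Data.Integer as ℤ using (ℤ; +_)
open import Data.Rational as ℚ using (ℚ; 0ℚ; 1ℚ; _+_; _*_; _-_; _÷_; ↥_; ↧ₙ_; ≢-nonZero)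
open import Data.Rational.Properties using (_≟_)
open import Data.Product using (_×_)
open import Relation.Nullary using (¬_; yes; no)

ℕ→ℚ : ℕ → ℚ
ℕ→ℚ n = ℚ.fromℚᵘ (ℚᵘfrom n)
  where
  open import Data.Rational.Unnormalised as U using ()
  ℚᵘfrom : ℕ → U.ℚᵘ
  ℚᵘfrom n = U.mkℚᵘ (+ n) 0

infixr 8 _^_
infixl 7 _÷′_

_^_ : ℚ → ℕ → ℚ
x ^ zero = 1ℚ
x ^ suc n = x * (x ^ n)

-- total division: x / y, defined as 0 when y = 0 (only used where y ≠ 0)
_÷′_ : ℚ → ℚ → ℚ
x ÷′ y with y ≟ 0ℚ
... | yes _ = 0ℚ
... | no y≢0 = _÷_ x y {{≢-nonZero y≢0}}

sumTo : ℕ → (ℕ → ℚ) → ℚ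
sumTo zero f = f 0
sumTo (suc n) f = sumTo n f + f (suc n)

-- x ∈ ℤ_p : denominator (in lowest terms) not divisible by p
InZ : ℕ → ℚ → Set
InZ p x = ¬ (p ∣ ↧ₙ x)

CongMod : ℕ → ℚ → ℚ → Set
CongMod p x y = InZ p x × InZ p y × (p ∣ ℤ.∣ ↥ (x - y) ∣)

A : ℕ → ℕ
A n = go n
  where
  term : ℕ → ℕ
  term k = ((2 ℕ.* k) C k) ℕ.* ((2 ℕ.* n ℕ.∸ 2 ℕ.* k) C (n ℕ.∸ k)) ℕ.* (n C k) ℕ.* (n C k)
  go : ℕ → ℕ
  go zero = term 0
  go (suc m) = go m ℕ.+ term (suc m)

{-# OPTIONS --safe #-}
-- With S(a,b) = (2a)! (2b)! / (a! b! (a+b)!) one has A_n = Σ_k C(n,k)³ S(k,n-k). Writing one factor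
-- C(n,k)² as Σ_j C(k,j) C(n-k,j) C(n+j,n) and summing over k by means of 4 S(a,b) = S(a+1,b) + S(a,b+1)
-- gives A_n = Σ_j C(2j,j)² C(3j,j) C(n+j,3j) 4^(n-2j). In Σ_{n<p} A_n u^n the coefficient of
-- C(2j,j)² C(3j,j) is then, for 3j < p, congruent to u^(2j) Σ_{m<p} C(m+3j,3j) (4u)^m, hence to
-- u^(2j) (1-4u)^(-3j) by repeated multiplication by 1-4u and Fermat's theorem; for p ≤ 3j < 3p the factor
-- C(2j,j) C(3j,j) = (3j)! / j!³ is divisible by p. All this takes place in ℤ, where u and
-- u² / (1-4u)³ are replaced by integers congruent to them.
module Submission where

import Data.Nat as ℕ
import Data.Nat.Properties as ℕ
import Data.Nat.Divisibility as ℕ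
open import Data.Nat using (ℕ; zero; suc; _∸_; s≤s; z≤n; _!)
open import Data.Nat.Combinatorics using (_C_; nCk+nC[k+1]≡[n+1]C[k+1])
open import Data.Nat.Coprimality using (recompute)
open import Data.Nat.Primality using (Prime; euclidsLemma; prime⇒nonZero; prime⇒nonTrivial)
open import Data.Nat.Tactic.RingSolver using () renaming (solve-∀ to ℕ-solve-∀)
open import Data.Integer as ℤ using (ℤ; +_; -[1+_]; 0ℤ; 1ℤ; ∣_∣)
open import Data.Integer.Divisibility.Signed
open import Data.Integer.Tactic.RingSolver using (solve-∀)
open import Data.Product using (_,_; ∃)
open import Data.Sum using (inj₁; inj₂)
open import Relation.Nullary using (¬_; yes; no; contradiction)
open import Relation.Binary.Bundles using (Setoid)
import Relation.Binary.Reasoning.Setoid as SetoidReasoning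
open import Relation.Binary.PropositionalEquality
  using (_≡_; refl; sym; trans; cong; cong₂; subst; module ≡-Reasoning)

-- The recurrence for S acts on sums of S along an antidiagonal, weighted by one row of binomial
-- coefficients; weights C(n,k)³ are out of its reach. The expansion of C(n,k)² is chosen to meet
-- the remaining factor: C(n,k) C(k,j) C(n-k,j) = C(n,2j) C(2j,j) C(n-2j,k-j). So k survives only in
-- row n-2j, and the row sum is 4^(n-2j) S(j,j) with S(j,j) = C(2j,j). The factors free of k combine
-- through C(n+j,n) C(n,2j) = C(n+j,3j) C(3j,j). The exponent of 1-4u also needs a reason, since the
-- full series with terms C(m+3j,3j) x^m is (1-x)^(-3j-1). Cut off at p, the geometric series is
-- (1-x^p)/(1-x), which Fermat turns into 1 when p does not divide 1-x. One factor 1-x is thus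
-- absent from the start, and the later truncation errors are multiples of C(p+r,r+1) with r+1 < p,
-- which p divides.

module Integral where

  open import Data.Integer using (_+_; _*_; _-_; -_; _^_; NonZero; ≢-nonZero)
  open import Data.Integer.Properties
  open ≡-Reasoning

  -- Finite sums of integers

  ∑ : ℕ → (ℕ → ℤ) → ℤ
  ∑ zero    f = 0ℤ
  ∑ (suc n) f = ∑ n f + f n

  ∑-cong : ∀ n {f g : ℕ → ℤ} → (∀ k → k ℕ.< n → f k ≡ g k) → ∑ n f ≡ ∑ n g
  ∑-cong zero    h = refl
  ∑-cong (suc n) h = cong₂ _+_ (∑-cong n (λ k k<n → h k (ℕ.m<n⇒m<1+n k<n))) (h n ℕ.≤-refl)

  ∑-zero : ∀ n {f : ℕ → ℤ} → (∀ k → k ℕ.< n → f k ≡ 0ℤ) → ∑ n f ≡ 0ℤ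
  ∑-zero zero    h = refl
  ∑-zero (suc n) h = cong₂ _+_ (∑-zero n (λ k k<n → h k (ℕ.m<n⇒m<1+n k<n))) (h n ℕ.≤-refl)

  ∑-distrib-+ : ∀ n (f g : ℕ → ℤ) → ∑ n (λ k → f k + g k) ≡ ∑ n f + ∑ n g
  ∑-distrib-+ zero    f g = refl
  ∑-distrib-+ (suc n) f g =
    trans (cong (_+ (f n + g n)) (∑-distrib-+ n f g)) (lem (∑ n f) (∑ n g) (f n) (g n))
    where
    lem : ∀ a b x y → (a + b) + (x + y) ≡ (a + x) + (b + y)
    lem = solve-∀

  *-distribˡ-∑ : ∀ n c (f : ℕ → ℤ) → ∑ n (λ k → c * f k) ≡ c * ∑ n f
  *-distribˡ-∑ zero    c f = sym (*-zeroʳ c)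
  *-distribˡ-∑ (suc n) c f =
    trans (cong (_+ c * f n) (*-distribˡ-∑ n c f)) (sym (*-distribˡ-+ c (∑ n f) (f n)))

  ∑-swap : ∀ m n (f : ℕ → ℕ → ℤ) → ∑ m (λ i → ∑ n (f i)) ≡ ∑ n (λ j → ∑ m (λ i → f i j))
  ∑-swap zero    n f = sym (∑-zero n (λ _ _ → refl))
  ∑-swap (suc m) n f =
    trans (cong (_+ ∑ n (f m)) (∑-swap m n f)) (sym (∑-distrib-+ n (λ j → ∑ m (λ i → f i j)) (f m)))

  ∑-split : ∀ m n (f : ℕ → ℤ) → ∑ (m ℕ.+ n) f ≡ ∑ m f + ∑ n (λ k → f (m ℕ.+ k))
  ∑-split m zero    f rewrite ℕ.+-identityʳ m = sym (+-identityʳ _)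
  ∑-split m (suc n) f rewrite ℕ.+-suc m n =
    trans (cong (_+ f (m ℕ.+ n)) (∑-split m n f)) (+-assoc (∑ m f) _ _)

  ∑-head : ∀ n (f : ℕ → ℤ) → ∑ (suc n) f ≡ f 0 + ∑ n (λ k → f (suc k))
  ∑-head n f = trans (∑-split 1 n f) (cong (_+ ∑ n (λ k → f (suc k))) (+-identityˡ (f 0)))

  -- Binomial coefficients in ℤ

  binom : ℕ → ℕ → ℤ
  binom _       zero    = 1ℤ
  binom zero    (suc k) = 0ℤ
  binom (suc n) (suc k) = binom n k + binom n (suc k)

  n<k⇒binom≡0 : ∀ {n k} → n ℕ.< k → binom n k ≡ 0ℤ
  n<k⇒binom≡0 {zero}  {suc k} _         = refl
  n<k⇒binom≡0 {suc n} {suc k} (s≤s n<k) =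
    cong₂ _+_ (n<k⇒binom≡0 n<k) (n<k⇒binom≡0 (ℕ.m<n⇒m<1+n n<k))

  binom-diag : ∀ n → binom n n ≡ 1ℤ
  binom-diag zero    = refl
  binom-diag (suc n) = cong₂ _+_ (binom-diag n) (n<k⇒binom≡0 {n} ℕ.≤-refl)

  binom-sym : ∀ a b → binom (a ℕ.+ b) a ≡ binom (a ℕ.+ b) b
  binom-sym zero    b    = sym (binom-diag b)
  binom-sym (suc a) zero rewrite ℕ.+-identityʳ a = binom-diag (suc a)
  binom-sym (suc a) (suc b) = begin
    binom (a ℕ.+ suc b) a + binom (a ℕ.+ suc b) (suc a)
      ≡⟨ cong₂ _+_ (binom-sym a (suc b)) (cong (λ n → binom n (suc a)) (ℕ.+-suc a b)) ⟩
    binom (a ℕ.+ suc b) (suc b) + binom (suc a ℕ.+ b) (suc a)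
      ≡⟨ cong (λ z → binom (a ℕ.+ suc b) (suc b) + z) (binom-sym (suc a) b) ⟩
    binom (a ℕ.+ suc b) (suc b) + binom (suc a ℕ.+ b) b
      ≡⟨ cong (λ n → binom (a ℕ.+ suc b) (suc b) + binom n b) (sym (ℕ.+-suc a b)) ⟩
    binom (a ℕ.+ suc b) (suc b) + binom (a ℕ.+ suc b) b
      ≡⟨ +-comm (binom (a ℕ.+ suc b) (suc b)) _ ⟩
    binom (a ℕ.+ suc b) b + binom (a ℕ.+ suc b) (suc b) ∎

  binom-absorb : ∀ n k → + suc k * binom (suc n) (suc k) ≡ + suc n * binom n k
  binom-absorb zero    zero    = refl
  binom-absorb zero    (suc k) = *-zeroʳ (+ suc (suc k))
  binom-absorb (suc n) zero    = begin
    1ℤ * (1ℤ + binom (suc n) 1)   ≡⟨ *-distribˡ-+ 1ℤ 1ℤ (binom (suc n) 1) ⟩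
    1ℤ + 1ℤ * binom (suc n) 1     ≡⟨ cong (λ z → 1ℤ + z) (binom-absorb n zero) ⟩
    1ℤ + + suc n * 1ℤ             ≡⟨ cong (λ x → 1ℤ + x) (*-identityʳ (+ suc n)) ⟩
    + suc (suc n)                 ≡⟨ sym (*-identityʳ _) ⟩
    + suc (suc n) * 1ℤ            ∎
  binom-absorb (suc n) (suc k) = begin
    + suc (suc k) * (binom (suc n) (suc k) + binom (suc n) (suc (suc k)))
      ≡⟨ split (+ suc k) (binom (suc n) (suc k)) (+ suc (suc k)) (binom (suc n) (suc (suc k))) refl ⟩
    binom (suc n) (suc k) + (+ suc k * binom (suc n) (suc k) + + suc (suc k) * binom (suc n) (suc (suc k)))
      ≡⟨ cong₂ (λ x y → binom (suc n) (suc k) + (x + y)) (binom-absorb n k) (binom-absorb n (suc k)) ⟩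
    binom (suc n) (suc k) + (+ suc n * binom n k + + suc n * binom n (suc k))
      ≡⟨ join (+ suc n) (binom n k) (binom n (suc k)) ⟩
    + suc (suc n) * binom (suc n) (suc k) ∎
    where
    split : ∀ c x d y → d ≡ 1ℤ + c → d * (x + y) ≡ x + (c * x + d * y)
    split c x d y refl = lem c x y
      where
      lem : ∀ c x y → (1ℤ + c) * (x + y) ≡ x + (c * x + (1ℤ + c) * y)
      lem = solve-∀
    join : ∀ c x y → (x + y) + (c * x + c * y) ≡ (1ℤ + c) * (x + y)
    join = solve-∀

  binom-! : ∀ a b → binom (a ℕ.+ b) a * (+ (a !) * + (b !)) ≡ + ((a ℕ.+ b) !)
  binom-! zero    b = trans (*-identityˡ _) (*-identityˡ _)
  binom-! (suc a) b = begin
    X * (+ (suc a ℕ.* a !) * + (b !))           ≡⟨ cong (λ f → X * (f * + (b !))) (pos-* (suc a) (a !)) ⟩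
    X * ((+ suc a * + (a !)) * + (b !))         ≡⟨ left X (+ suc a) (+ (a !)) (+ (b !)) ⟩
    (+ suc a * X) * (+ (a !) * + (b !))         ≡⟨ cong (_* (+ (a !) * + (b !))) (binom-absorb (a ℕ.+ b) a) ⟩
    (+ suc (a ℕ.+ b) * binom (a ℕ.+ b) a) * (+ (a !) * + (b !)) ≡⟨ *-assoc (+ suc (a ℕ.+ b)) (binom (a ℕ.+ b) a) (+ (a !) * + (b !)) ⟩
    + suc (a ℕ.+ b) * (binom (a ℕ.+ b) a * (+ (a !) * + (b !))) ≡⟨ cong (+ suc (a ℕ.+ b) *_) (binom-! a b) ⟩
    + suc (a ℕ.+ b) * + ((a ℕ.+ b) !)           ≡⟨ sym (pos-* (suc (a ℕ.+ b)) ((a ℕ.+ b) !)) ⟩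
    + (suc (a ℕ.+ b) !)                         ∎
    where
    X = binom (suc (a ℕ.+ b)) (suc a)
    left : ∀ x s f g → x * ((s * f) * g) ≡ (s * x) * (f * g)
    left = solve-∀

  -- Sums weighted by binomial coefficients

  ∑-pascal : ∀ m (g : ℕ → ℤ) →
    ∑ (suc (suc m)) (λ i → binom (suc m) i * g i) ≡ ∑ (suc m) (λ i → binom m i * (g i + g (suc i)))
  ∑-pascal m g = begin
    ∑ (suc (suc m)) (λ i → binom (suc m) i * g i)
      ≡⟨ ∑-head (suc m) _ ⟩
    1ℤ * g 0 + ∑ (suc m) (λ i → (binom m i + binom m (suc i)) * g (suc i))
      ≡⟨ cong (λ z → 1ℤ * g 0 + z) (trans (∑-cong (suc m) (λ i _ → *-distribʳ-+ (g (suc i)) (binom m i) (binom m (suc i))))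
                            (∑-distrib-+ (suc m) (λ i → binom m i * g (suc i)) (λ i → binom m (suc i) * g (suc i)))) ⟩
    1ℤ * g 0 + (Y + ∑ (suc m) (λ i → binom m (suc i) * g (suc i)))
      ≡⟨ rearrange (1ℤ * g 0) Y _ ⟩
    (1ℤ * g 0 + ∑ (suc m) (λ i → binom m (suc i) * g (suc i))) + Y
      ≡⟨ cong (_+ Y) (sym (∑-head (suc m) (λ i → binom m i * g i))) ⟩
    (∑ (suc m) (λ i → binom m i * g i) + binom m (suc m) * g (suc m)) + Y
      ≡⟨ cong (_+ Y) (trans (cong (λ z → ∑ (suc m) (λ i → binom m i * g i) + z)
           (trans (cong (_* g (suc m)) (n<k⇒binom≡0 {m} ℕ.≤-refl)) (*-zeroˡ (g (suc m)))))
           (+-identityʳ (∑ (suc m) (λ i → binom m i * g i)))) ⟩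
    ∑ (suc m) (λ i → binom m i * g i) + Y
      ≡⟨ sym (∑-distrib-+ (suc m) (λ i → binom m i * g i) (λ i → binom m i * g (suc i))) ⟩
    ∑ (suc m) (λ i → binom m i * g i + binom m i * g (suc i))
      ≡⟨ ∑-cong (suc m) (λ i _ → sym (*-distribˡ-+ (binom m i) (g i) (g (suc i)))) ⟩
    ∑ (suc m) (λ i → binom m i * (g i + g (suc i))) ∎
    where
    Y = ∑ (suc m) (λ i → binom m i * g (suc i))
    rearrange : ∀ a b c → a + (b + c) ≡ (a + c) + b
    rearrange = solve-∀

  -- Each use of `∑-pascal` descends one row, and the hypothesis on `h` then releases one factor q.
  -- The case q = 4 sums super Catalan numbers; the case q = 1 + x is the binomial theorem. The
  -- hypothesis is restricted to i ≤ m because `h` may contain the truncated difference m ∸ i.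
  ∑-binom-geometric : ∀ q (h : ℕ → ℕ → ℤ) →
    (∀ m i → i ℕ.≤ m → h (suc m) i + h (suc m) (suc i) ≡ q * h m i) →
    ∀ m → ∑ (suc m) (λ i → binom m i * h m i) ≡ q ^ m * h 0 0
  ∑-binom-geometric q h step zero    = +-identityˡ _
  ∑-binom-geometric q h step (suc m) = begin
    ∑ (suc (suc m)) (λ i → binom (suc m) i * h (suc m) i)
      ≡⟨ ∑-pascal m (h (suc m)) ⟩
    ∑ (suc m) (λ i → binom m i * (h (suc m) i + h (suc m) (suc i)))
      ≡⟨ ∑-cong (suc m) (λ { i (s≤s i≤m) →
           trans (cong (binom m i *_) (step m i i≤m)) (swap (binom m i) q (h m i)) }) ⟩
    ∑ (suc m) (λ i → q * (binom m i * h m i))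
      ≡⟨ *-distribˡ-∑ (suc m) q _ ⟩
    q * ∑ (suc m) (λ i → binom m i * h m i)
      ≡⟨ cong (q *_) (∑-binom-geometric q h step m) ⟩
    q * (q ^ m * h 0 0)
      ≡⟨ sym (*-assoc q (q ^ m) (h 0 0)) ⟩
    q ^ suc m * h 0 0 ∎
    where
    swap : ∀ a b c → a * (b * c) ≡ b * (a * c)
    swap = solve-∀

  -- Induction on x, with m and n free. Pascal's rule on C(x+1+k,m+n+2) leaves the same sum at x and
  -- the sum `U` with lower index m+n+1. For a = C(m,k), a′ = C(m+1,k), and b, b′ likewise for n,
  -- the identity a′b′ + ab = ab′ + a′b + (a′-a)(b′-b) gives U + V = T₁ + T₂ + W, the last sum after
  -- an index shift. Pascal's rule once more gives W = T₀ + V, so U = T₁ + T₂ + T₀, three instances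
  -- at x. Any N > m serves, since C(m,k) vanishes for k > m.
  binom-product : ∀ N m n x → m ℕ.< N →
    ∑ N (λ k → binom m k * binom n k * binom (x ℕ.+ k) (m ℕ.+ n)) ≡ binom x m * binom x n
  binom-product (suc N) zero n x _ = begin
    ∑ (suc N) (λ k → binom 0 k * binom n k * binom (x ℕ.+ k) n)
      ≡⟨ ∑-head N _ ⟩
    1ℤ * binom (x ℕ.+ 0) n + ∑ N (λ k → 0ℤ * binom n (suc k) * binom (x ℕ.+ suc k) n)
      ≡⟨ cong₂ (λ y z → 1ℤ * binom y n + z) (ℕ.+-identityʳ x) (∑-zero N (λ _ _ → refl)) ⟩
    1ℤ * binom x n + 0ℤ ≡⟨ +-identityʳ _ ⟩
    1ℤ * binom x n ∎
  binom-product (suc N) (suc m) zero x _ = begin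
    ∑ (suc N) (λ k → binom (suc m) k * binom 0 k * binom (x ℕ.+ k) (suc m ℕ.+ 0))
      ≡⟨ ∑-head N _ ⟩
    1ℤ * binom (x ℕ.+ 0) (suc m ℕ.+ 0) + ∑ N (λ k → binom (suc m) (suc k) * 0ℤ * binom (x ℕ.+ suc k) (suc m ℕ.+ 0))
      ≡⟨ cong₂ _+_ (cong₂ (λ y z → 1ℤ * binom y z) (ℕ.+-identityʳ x) (ℕ.+-identityʳ (suc m)))
           (∑-zero N (λ k _ → cong (_* binom (x ℕ.+ suc k) (suc m ℕ.+ 0)) (*-zeroʳ (binom (suc m) (suc k))))) ⟩
    1ℤ * binom x (suc m) + 0ℤ ≡⟨ +-identityʳ _ ⟩
    1ℤ * binom x (suc m)      ≡⟨ *-comm 1ℤ _ ⟩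
    binom x (suc m) * 1ℤ ∎
  binom-product N (suc m) (suc n) zero _ = ∑-zero N vanish
    where
    -- At x = 0 a nonzero last factor would need k ≥ m+n+2, but then C(m+1,k) is zero.
    vanish : ∀ k → k ℕ.< N → binom (suc m) k * binom (suc n) k * binom k (suc m ℕ.+ suc n) ≡ 0ℤ
    vanish k _ with k ℕ.≤? suc m
    ... | yes k≤m = trans (cong (binom (suc m) k * binom (suc n) k *_)
                      (n<k⇒binom≡0 {k} (ℕ.≤-<-trans k≤m (ℕ.m<m+n (suc m) (s≤s z≤n)))))
                      (*-zeroʳ (binom (suc m) k * binom (suc n) k))
    ... | no  k≰m = cong (λ b → b * binom (suc n) k * binom k (suc m ℕ.+ suc n))
                      (n<k⇒binom≡0 (ℕ.≰⇒> k≰m))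
  binom-product (suc N) (suc m) (suc n) (suc x) (s≤s m<N) = begin
    ∑ (suc N) (λ k → binom (suc m) k * binom (suc n) k *
        (binom (x ℕ.+ k) (m ℕ.+ suc n) + binom (x ℕ.+ k) (suc m ℕ.+ suc n)))
      ≡⟨ ∑-cong (suc N) (λ k _ → *-distribˡ-+ (binom (suc m) k * binom (suc n) k)
           (binom (x ℕ.+ k) (m ℕ.+ suc n)) (binom (x ℕ.+ k) (suc m ℕ.+ suc n))) ⟩
    ∑ (suc N) (λ k → binom (suc m) k * binom (suc n) k * binom (x ℕ.+ k) (m ℕ.+ suc n)
        + binom (suc m) k * binom (suc n) k * binom (x ℕ.+ k) (suc m ℕ.+ suc n))
      ≡⟨ ∑-distrib-+ (suc N) _ _ ⟩
    ∑ (suc N) (λ k → binom (suc m) k * binom (suc n) k * binom (x ℕ.+ k) (m ℕ.+ suc n))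
      + ∑ (suc N) (λ k → binom (suc m) k * binom (suc n) k * binom (x ℕ.+ k) (suc m ℕ.+ suc n))
      ≡⟨ cong₂ _+_ (∑-cong (suc N) (λ k _ → cong (λ q → binom (suc m) k * binom (suc n) k * binom (x ℕ.+ k) q) (ℕ.+-suc m n)))
                   (binom-product (suc N) (suc m) (suc n) x (s≤s m<N)) ⟩
    U + binom x (suc m) * binom x (suc n)
      ≡⟨ cong (_+ binom x (suc m) * binom x (suc n)) U≡ ⟩
    (binom x m * binom x (suc n) + binom x (suc m) * binom x n + binom x m * binom x n)
      + binom x (suc m) * binom x (suc n)
      ≡⟨ factor (binom x m) (binom x (suc m)) (binom x n) (binom x (suc n)) ⟩
    (binom x m + binom x (suc m)) * (binom x n + binom x (suc n)) ∎
    where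
    factor : ∀ a a′ b b′ → (a * b′ + a′ * b + a * b) + a′ * b′ ≡ (a + a′) * (b + b′)
    factor = solve-∀
    F : ℕ → ℤ
    F k = binom (x ℕ.+ k) (suc (m ℕ.+ n))
    U = ∑ (suc N) (λ k → binom (suc m) k * binom (suc n) k * F k)
    V = ∑ (suc N) (λ k → binom m k * binom n k * F k)
    T₁ = ∑ (suc N) (λ k → binom m k * binom (suc n) k * F k)
    T₂ = ∑ (suc N) (λ k → binom (suc m) k * binom n k * F k)
    T₀ = ∑ (suc N) (λ k → binom m k * binom n k * binom (x ℕ.+ k) (m ℕ.+ n))
    W = ∑ (suc N) (λ k → binom m k * binom n k * F (suc k))
    -- By Pascal's rule h (suc k) is the summand of W at k.
    h : ℕ → ℤ
    h k = (binom (suc m) k - binom m k) * (binom (suc n) k - binom n k) * F k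

    T₀+V≡W : T₀ + V ≡ W
    T₀+V≡W = trans (sym (∑-distrib-+ (suc N) _ _)) (∑-cong (suc N) (λ k _ →
      trans (sym (*-distribˡ-+ (binom m k * binom n k) (binom (x ℕ.+ k) (m ℕ.+ n)) (F k)))
            (cong (λ y → binom m k * binom n k * binom y (suc (m ℕ.+ n))) (sym (ℕ.+-suc x k)))))

    ∑h≡W : ∑ (suc N) h ≡ W
    ∑h≡W = begin
      ∑ (suc N) h
        -- The term `h 0` is zero because C(m+1,0) = C(m,0). After the shift the missing term k = N
        -- of `W` can be added, as m < N makes C(m,N) zero.
        ≡⟨ trans (∑-head N h) (+-identityˡ _) ⟩
      ∑ N (λ k → h (suc k))
        ≡⟨ ∑-cong N (λ k _ → lem (binom m k) (binom m (suc k)) (binom n k) (binom n (suc k)) (F (suc k))) ⟩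
      ∑ N (λ k → binom m k * binom n k * F (suc k))
        ≡⟨ sym (+-identityʳ _) ⟩
      ∑ N (λ k → binom m k * binom n k * F (suc k)) + 0ℤ
        ≡⟨ cong (λ z → ∑ N (λ k → binom m k * binom n k * F (suc k)) + z) (sym (cong (λ b → b * binom n N * F (suc N)) (n<k⇒binom≡0 m<N))) ⟩
      W ∎
      where
      lem : ∀ a a′ b b′ f → (a + a′ - a′) * (b + b′ - b′) * f ≡ a * b * f
      lem = solve-∀

    U+V≡ : U + V ≡ T₁ + T₂ + ∑ (suc N) h
    U+V≡ = begin
      U + V
        ≡⟨ sym (∑-distrib-+ (suc N) _ _) ⟩
      ∑ (suc N) (λ k → binom (suc m) k * binom (suc n) k * F k + binom m k * binom n k * F k)
        ≡⟨ ∑-cong (suc N) (λ k _ → lem (binom (suc m) k) (binom (suc n) k) (binom m k) (binom n k) (F k)) ⟩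
      ∑ (suc N) (λ k → (binom m k * binom (suc n) k * F k + binom (suc m) k * binom n k * F k) + h k)
        ≡⟨ trans (∑-distrib-+ (suc N) _ h) (cong (_+ ∑ (suc N) h) (∑-distrib-+ (suc N) _ _)) ⟩
      T₁ + T₂ + ∑ (suc N) h ∎
      where
      lem : ∀ a′ b′ a b f → a′ * b′ * f + a * b * f ≡ (a * b′ * f + a′ * b * f) + (a′ - a) * (b′ - b) * f
      lem = solve-∀

    U≡ : U ≡ binom x m * binom x (suc n) + binom x (suc m) * binom x n + binom x m * binom x n
    U≡ = begin
      U                              ≡⟨ cancel U V ⟩
      (U + V) - V                    ≡⟨ cong (_- V) (trans U+V≡ (cong (λ z → T₁ + T₂ + z) (trans ∑h≡W (sym T₀+V≡W)))) ⟩
      (T₁ + T₂ + (T₀ + V)) - V       ≡⟨ cancel′ (T₁ + T₂) T₀ V ⟩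
      T₁ + T₂ + T₀                   ≡⟨ cong₂ (λ y z → y + z + T₀)
          (trans (∑-cong (suc N) (λ k _ → cong (λ q → binom m k * binom (suc n) k * binom (x ℕ.+ k) q) (sym (ℕ.+-suc m n))))
                 (binom-product (suc N) m (suc n) x (ℕ.m<n⇒m<1+n m<N)))
          (binom-product (suc N) (suc m) n x (s≤s m<N)) ⟩
      binom x m * binom x (suc n) + binom x (suc m) * binom x n + T₀
        ≡⟨ cong (λ z → binom x m * binom x (suc n) + binom x (suc m) * binom x n + z) (binom-product (suc N) m n x (ℕ.m<n⇒m<1+n m<N)) ⟩
      binom x m * binom x (suc n) + binom x (suc m) * binom x n + binom x m * binom x n ∎
      where
      cancel : ∀ u v → u ≡ (u + v) - v
      cancel = solve-∀
      cancel′ : ∀ t s v → (t + (s + v)) - v ≡ t + s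
      cancel′ = solve-∀

  -- Products of binomial coefficients, compared through factorials

  binom-nonZero : ∀ a b → NonZero (binom (a ℕ.+ b) a)
  binom-nonZero a b = ≢-nonZero {binom (a ℕ.+ b) a} λ binom≡0 → ℕ.≢-nonZero⁻¹ ((a ℕ.+ b) !) {{ℕ._!≢0 (a ℕ.+ b)}}
    (+-injective (trans (sym (binom-! a b)) (cong (_* (+ (a !) * + (b !))) binom≡0)))

  !-nonZero : ∀ n → NonZero (+ (n !))
  !-nonZero n = n ℕ.!≢0

  *-nonZero : ∀ i j → NonZero i → NonZero j → NonZero (i * j)
  *-nonZero i j i≢0 j≢0 = i*j≢0 i j {{i≢0}} {{j≢0}}

  -- Both sides are the multinomial coefficient (a+b+c)! / (a! b! c!).
  trinomial-revision : ∀ a b c →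
    binom ((a ℕ.+ b) ℕ.+ c) (a ℕ.+ b) * binom (a ℕ.+ b) a ≡
    binom (a ℕ.+ (b ℕ.+ c)) a * binom (b ℕ.+ c) b
  trinomial-revision a b c = *-cancelʳ-≡ (X * Y) (Z * W) (a! * (b! * c!))
    {{*-nonZero a! (b! * c!) (!-nonZero a) (*-nonZero b! c! (!-nonZero b) (!-nonZero c))}} (begin
    (X * Y) * (a! * (b! * c!))  ≡⟨ l₁ X Y a! b! c! ⟩
    X * ((Y * (a! * b!)) * c!)  ≡⟨ cong (λ z → X * (z * c!)) (binom-! a b) ⟩
    X * (+ ((a ℕ.+ b) !) * c!) ≡⟨ binom-! (a ℕ.+ b) c ⟩
    + (((a ℕ.+ b) ℕ.+ c) !)  ≡⟨ cong (λ n → + (n !)) (ℕ.+-assoc a b c) ⟩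
    + ((a ℕ.+ (b ℕ.+ c)) !)  ≡⟨ sym (binom-! a (b ℕ.+ c)) ⟩
    Z * (a! * + ((b ℕ.+ c) !)) ≡⟨ cong (λ z → Z * (a! * z)) (sym (binom-! b c)) ⟩
    Z * (a! * (W * (b! * c!)))  ≡⟨ l₂ Z W a! (b! * c!) ⟩
    (Z * W) * (a! * (b! * c!)) ∎)
    where
    X = binom ((a ℕ.+ b) ℕ.+ c) (a ℕ.+ b)
    Y = binom (a ℕ.+ b) a
    Z = binom (a ℕ.+ (b ℕ.+ c)) a
    W = binom (b ℕ.+ c) b
    a! = + (a !)
    b! = + (b !)
    c! = + (c !)
    l₁ : ∀ x y a b c → (x * y) * (a * (b * c)) ≡ x * ((y * (a * b)) * c)
    l₁ = solve-∀
    l₂ : ∀ z w a b → z * (a * (w * b)) ≡ (z * w) * (a * b)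
    l₂ = solve-∀

  central : ℕ → ℤ
  central n = binom (n ℕ.+ n) n

  -- Both sides are (2j+i+l)! / (j!² i! l!). With k = j + i and n = 2j + i + l fixed, the right side
  -- depends on k only through C(i+l,i).
  binom-regroup : ∀ j i l →
    binom ((j ℕ.+ i) ℕ.+ (j ℕ.+ l)) (j ℕ.+ i) * (binom (j ℕ.+ i) j * binom (j ℕ.+ l) j) ≡
    binom ((j ℕ.+ j) ℕ.+ (i ℕ.+ l)) (j ℕ.+ j) * central j * binom (i ℕ.+ l) i
  binom-regroup j i l = *-cancelʳ-≡ (X * (Y * Z)) (X′ * central j * Z′) ((j! * i!) * (j! * l!))
    {{*-nonZero (j! * i!) (j! * l!) (*-nonZero j! i! (!-nonZero j) (!-nonZero i)) (*-nonZero j! l! (!-nonZero j) (!-nonZero l))}} (begin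
    (X * (Y * Z)) * ((j! * i!) * (j! * l!)) ≡⟨ l₁ X Y Z (j! * i!) (j! * l!) ⟩
    X * ((Y * (j! * i!)) * (Z * (j! * l!))) ≡⟨ cong₂ (λ y z → X * (y * z)) (binom-! j i) (binom-! j l) ⟩
    X * (+ ((j ℕ.+ i) !) * + ((j ℕ.+ l) !)) ≡⟨ binom-! (j ℕ.+ i) (j ℕ.+ l) ⟩
    + (((j ℕ.+ i) ℕ.+ (j ℕ.+ l)) !) ≡⟨ cong (λ n → + (n !)) (ℕ-interchange j i j l) ⟩
    + (((j ℕ.+ j) ℕ.+ (i ℕ.+ l)) !) ≡⟨ sym (binom-! (j ℕ.+ j) (i ℕ.+ l)) ⟩
    X′ * (+ ((j ℕ.+ j) !) * + ((i ℕ.+ l) !)) ≡⟨ sym (cong₂ (λ y z → X′ * (y * z)) (binom-! j j) (binom-! i l)) ⟩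
    X′ * ((central j * (j! * j!)) * (Z′ * (i! * l!))) ≡⟨ l₂ X′ (central j) Z′ j! i! l! ⟩
    (X′ * central j * Z′) * ((j! * i!) * (j! * l!)) ∎)
    where
    X = binom ((j ℕ.+ i) ℕ.+ (j ℕ.+ l)) (j ℕ.+ i)
    Y = binom (j ℕ.+ i) j
    Z = binom (j ℕ.+ l) j
    X′ = binom ((j ℕ.+ j) ℕ.+ (i ℕ.+ l)) (j ℕ.+ j)
    Z′ = binom (i ℕ.+ l) i
    j! = + (j !)
    i! = + (i !)
    l! = + (l !)
    ℕ-interchange : ∀ a b c d → (a ℕ.+ b) ℕ.+ (c ℕ.+ d) ≡ (a ℕ.+ c) ℕ.+ (b ℕ.+ d)
    ℕ-interchange = ℕ-solve-∀
    l₁ : ∀ x y z a b → (x * (y * z)) * (a * b) ≡ x * ((y * a) * (z * b))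
    l₁ = solve-∀
    l₂ : ∀ x c z j i l → x * ((c * (j * j)) * (z * (i * l))) ≡ (x * c * z) * ((j * i) * (j * l))
    l₂ = solve-∀

  -- Central binomial coefficients and super Catalan numbers

  central-suc : ∀ a → + suc a * central (suc a) ≡ + 2 * (+ suc (a ℕ.+ a) * central a)
  -- The extra factor a + 1 pays for a second use of absorption, after C(2a+1,a) has been replaced
  -- by C(2a+1,a+1).
  central-suc a = *-cancelˡ-≡ (+ suc a) (+ suc a * central (suc a)) (+ 2 * (+ suc (a ℕ.+ a) * central a)) (begin
    + suc a * (+ suc a * central (suc a))
      ≡⟨ cong (λ z → + suc a * z) (binom-absorb (a ℕ.+ suc a) a) ⟩
    + suc a * (+ suc (a ℕ.+ suc a) * binom (a ℕ.+ suc a) a)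
      ≡⟨ cong₂ (λ y z → + suc a * (+ suc y * z)) (ℕ.+-suc a a) (binom-sym a (suc a)) ⟩
    + suc a * (+ suc (suc (a ℕ.+ a)) * binom (a ℕ.+ suc a) (suc a))
      ≡⟨ cong (λ y → + suc a * (+ suc (suc (a ℕ.+ a)) * binom y (suc a))) (ℕ.+-suc a a) ⟩
    + suc a * (+ suc (suc (a ℕ.+ a)) * binom (suc (a ℕ.+ a)) (suc a))
      ≡⟨ swap (+ suc a) (+ suc (suc (a ℕ.+ a))) (binom (suc (a ℕ.+ a)) (suc a)) ⟩
    + suc (suc (a ℕ.+ a)) * (+ suc a * binom (suc (a ℕ.+ a)) (suc a))
      ≡⟨ cong (λ z → + suc (suc (a ℕ.+ a)) * z) (binom-absorb (a ℕ.+ a) a) ⟩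
    + suc (suc (a ℕ.+ a)) * (+ suc (a ℕ.+ a) * central a)
      ≡⟨ lem (+ a) (+ suc (a ℕ.+ a) * central a) ⟩
    + suc a * (+ 2 * (+ suc (a ℕ.+ a) * central a)) ∎)
    where
    swap : ∀ a b c → a * (b * c) ≡ b * (a * c)
    swap = solve-∀
    lem : ∀ a x → (1ℤ + (1ℤ + (a + a))) * x ≡ (1ℤ + a) * (+ 2 * x)
    lem = solve-∀

  -- superCatalan a b is (2a)! (2b)! / (a! b! (a + b)!); the recursion shows that it is an integer.
  superCatalan : ℕ → ℕ → ℤ
  superCatalan a zero    = central a
  superCatalan a (suc b) = + 4 * superCatalan a b - superCatalan (suc a) b

  -- The factorial formula without division. In the induction on b, multiplication by b + 1 turns
  -- both terms of the recursion into multiples of C(2a,a) C(2b,b), and the claim becomes 4(a+b+1) -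
  -- 2(2a+1) = 2(2b+1).
  superCatalan-binom : ∀ a b → superCatalan a b * binom (a ℕ.+ b) a ≡ central a * central b
  superCatalan-binom a zero =
    cong (λ z → central a * z) (trans (cong (λ n → binom n a) (ℕ.+-identityʳ a)) (binom-diag a))
  superCatalan-binom a (suc b) = *-cancelˡ-≡ (+ suc b)
    (superCatalan a (suc b) * binom (a ℕ.+ suc b) a) (central a * central (suc b)) (begin
    + suc b * ((+ 4 * S - S₁) * binom (a ℕ.+ suc b) a)
      ≡⟨ move (+ suc b) (+ 4 * S - S₁) (binom (a ℕ.+ suc b) a) ⟩
    (+ 4 * S - S₁) * (+ suc b * binom (a ℕ.+ suc b) a)
      ≡⟨ cong (λ z → (+ 4 * S - S₁) * z) absorb-right ⟩
    (+ 4 * S - S₁) * (+ suc (a ℕ.+ b) * B)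
      ≡⟨ expand S S₁ (+ suc (a ℕ.+ b)) B ⟩
    + 4 * (+ suc (a ℕ.+ b) * (S * B)) - S₁ * (+ suc (a ℕ.+ b) * B)
      ≡⟨ cong₂ (λ y z → + 4 * (+ suc (a ℕ.+ b) * y) - S₁ * z)
           (superCatalan-binom a b) (sym (binom-absorb (a ℕ.+ b) a)) ⟩
    + 4 * (+ suc (a ℕ.+ b) * (central a * central b)) - S₁ * (+ suc a * binom (suc a ℕ.+ b) (suc a))
      ≡⟨ cong (λ z → + 4 * (+ suc (a ℕ.+ b) * (central a * central b)) - z)
           (move S₁ (+ suc a) (binom (suc a ℕ.+ b) (suc a))) ⟩
    + 4 * (+ suc (a ℕ.+ b) * (central a * central b)) - + suc a * (S₁ * binom (suc a ℕ.+ b) (suc a))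
      ≡⟨ cong (λ z → + 4 * (+ suc (a ℕ.+ b) * (central a * central b)) - + suc a * z)
           (superCatalan-binom (suc a) b) ⟩
    + 4 * (+ suc (a ℕ.+ b) * (central a * central b)) - + suc a * (central (suc a) * central b)
      ≡⟨ cong (λ z → + 4 * (+ suc (a ℕ.+ b) * (central a * central b)) - z)
           (trans (sym (*-assoc (+ suc a) (central (suc a)) (central b))) (cong (_* central b) (central-suc a))) ⟩
    + 4 * (+ suc (a ℕ.+ b) * (central a * central b)) - + 2 * (+ suc (a ℕ.+ a) * central a) * central b
      ≡⟨ combine (+ a) (+ b) (central a) (central b) ⟩
    central a * (+ 2 * (+ suc (b ℕ.+ b) * central b))
      ≡⟨ cong (λ z → central a * z) (sym (central-suc b)) ⟩
    central a * (+ suc b * central (suc b))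
      ≡⟨ move (central a) (+ suc b) (central (suc b)) ⟩
    + suc b * (central a * central (suc b)) ∎)
    where
    S = superCatalan a b
    S₁ = superCatalan (suc a) b
    B = binom (a ℕ.+ b) a
    move : ∀ a b c → a * (b * c) ≡ b * (a * c)
    move = solve-∀
    expand : ∀ s t c b → (+ 4 * s - t) * (c * b) ≡ + 4 * (c * (s * b)) - t * (c * b)
    expand = solve-∀
    combine : ∀ a b x y → + 4 * ((1ℤ + (a + b)) * (x * y)) - + 2 * ((1ℤ + (a + a)) * x) * y
              ≡ x * (+ 2 * ((1ℤ + (b + b)) * y))
    combine = solve-∀
    absorb-right : + suc b * binom (a ℕ.+ suc b) a ≡ + suc (a ℕ.+ b) * B
    absorb-right = begin
      + suc b * binom (a ℕ.+ suc b) a             ≡⟨ cong (λ z → + suc b * z) (binom-sym a (suc b)) ⟩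
      + suc b * binom (a ℕ.+ suc b) (suc b)       ≡⟨ cong (λ n → + suc b * binom n (suc b)) (ℕ.+-suc a b) ⟩
      + suc b * binom (suc (a ℕ.+ b)) (suc b)     ≡⟨ binom-absorb (a ℕ.+ b) b ⟩
      + suc (a ℕ.+ b) * binom (a ℕ.+ b) b         ≡⟨ cong (λ z → + suc (a ℕ.+ b) * z) (sym (binom-sym a b)) ⟩
      + suc (a ℕ.+ b) * B ∎

  superCatalan-diag : ∀ j → superCatalan j j ≡ central j
  superCatalan-diag j =
    *-cancelʳ-≡ (superCatalan j j) (central j) (central j) {{binom-nonZero j j}} (superCatalan-binom j j)

  -- The entries lie on an antidiagonal; two neighbours on the next antidiagonal add up to 4 times
  -- an entry of this one, so every Pascal step yields a factor 4 until S(j,j) remains.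
  ∑-binom-superCatalan : ∀ j m →
    ∑ (suc m) (λ i → binom m i * superCatalan (j ℕ.+ i) (j ℕ.+ (m ∸ i))) ≡ (+ 4) ^ m * central j
  ∑-binom-superCatalan j m =
    trans (∑-binom-geometric (+ 4) (λ m i → superCatalan (j ℕ.+ i) (j ℕ.+ (m ∸ i))) step m)
          (cong (λ z → (+ 4) ^ m * z) (trans (cong₂ superCatalan (ℕ.+-identityʳ j) (ℕ.+-identityʳ j)) (superCatalan-diag j)))
    where
    lem : ∀ x y → (x - y) + y ≡ x
    lem = solve-∀
    step : ∀ m i → i ℕ.≤ m → superCatalan (j ℕ.+ i) (j ℕ.+ (suc m ∸ i)) + superCatalan (j ℕ.+ suc i) (j ℕ.+ (m ∸ i))
           ≡ + 4 * superCatalan (j ℕ.+ i) (j ℕ.+ (m ∸ i))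
    step m i i≤m rewrite ℕ.+-∸-assoc 1 i≤m | ℕ.+-suc j (m ∸ i) | ℕ.+-suc j i =
      lem (+ 4 * superCatalan (j ℕ.+ i) (j ℕ.+ (m ∸ i))) (superCatalan (suc (j ℕ.+ i)) (j ℕ.+ (m ∸ i)))

  -- The expansion of A_n

  domb : ℕ → ℤ
  domb n = ∑ (suc n) (λ k → central k * central (n ∸ k) * binom n k * binom n k)

  -- The last factor is C(3j,2j) instead of C(3j,j), the form in which trinomial revision delivers
  -- it.
  cubicCoeff : ℕ → ℤ
  cubicCoeff j = central j * central j * binom ((j ℕ.+ j) ℕ.+ j) (j ℕ.+ j)

  n<k+j⇒n∸k<j : ∀ {n k j} → k ℕ.≤ n → n ℕ.< k ℕ.+ j → n ∸ k ℕ.< j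
  n<k+j⇒n∸k<j {n} {k} {j} k≤n n<k+j = subst (n ∸ k ℕ.<_) (ℕ.m+n∸m≡n k j) (ℕ.∸-monoˡ-< n<k+j k≤n)

  -- The (k,j) term of the double sum for A_n, without the factor C(n+j,n), which does not depend on
  -- k.
  regrouped : ℕ → ℕ → ℕ → ℤ
  regrouped n j k = superCatalan k (n ∸ k) * (binom n k * (binom k j * binom (n ∸ k) j))

  module _ (n j : ℕ) where
    private
      G : ℕ → ℤ
      G = regrouped n j

      G-low : ∀ k → k ℕ.< j → G k ≡ 0ℤ
      G-low k k<j = begin
        G k ≡⟨ cong (λ z → superCatalan k (n ∸ k) * (binom n k * (z * binom (n ∸ k) j))) (n<k⇒binom≡0 k<j) ⟩
        superCatalan k (n ∸ k) * (binom n k * 0ℤ) ≡⟨ cong (λ z → superCatalan k (n ∸ k) * z) (*-zeroʳ (binom n k)) ⟩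
        superCatalan k (n ∸ k) * 0ℤ ≡⟨ *-zeroʳ (superCatalan k (n ∸ k)) ⟩
        0ℤ ∎

      G-high : ∀ k → n ∸ k ℕ.< j → G k ≡ 0ℤ
      G-high k n∸k<j = begin
        G k ≡⟨ cong (λ z → superCatalan k (n ∸ k) * (binom n k * (binom k j * z))) (n<k⇒binom≡0 n∸k<j) ⟩
        superCatalan k (n ∸ k) * (binom n k * (binom k j * 0ℤ)) ≡⟨ cong (λ z → superCatalan k (n ∸ k) * (binom n k * z)) (*-zeroʳ (binom k j)) ⟩
        superCatalan k (n ∸ k) * (binom n k * 0ℤ) ≡⟨ cong (λ z → superCatalan k (n ∸ k) * z) (*-zeroʳ (binom n k)) ⟩
        superCatalan k (n ∸ k) * 0ℤ ≡⟨ *-zeroʳ (superCatalan k (n ∸ k)) ⟩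
        0ℤ ∎

    -- When n < 2j, every k ≤ n has k < j or n - k < j, so C(k,j) or C(n-k,j) is zero.
    ∑-regrouped-vanish : n ℕ.< j ℕ.+ j → ∑ (suc n) G ≡ 0ℤ
    ∑-regrouped-vanish n<j+j = ∑-zero (suc n) λ { k (s≤s k≤n) → helper k k≤n }
      where
      helper : ∀ k → k ℕ.≤ n → G k ≡ 0ℤ
      helper k k≤n with k ℕ.<? j
      ... | yes k<j = G-low k k<j
      ... | no  k≮j = G-high k (n<k+j⇒n∸k<j k≤n (ℕ.<-≤-trans n<j+j (ℕ.+-monoˡ-≤ j (ℕ.≮⇒≥ k≮j))))

    -- Only the terms k = j + i with i ≤ m are nonzero; there `binom-regroup` leaves the weight
    -- C(m,i), and the antidiagonal sum applies.
    ∑-regrouped : ∀ m → n ≡ (j ℕ.+ j) ℕ.+ m →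
      ∑ (suc n) G ≡ binom n (j ℕ.+ j) * central j * ((+ 4) ^ m * central j)
    ∑-regrouped m n≡ = begin
      ∑ (suc n) G
        ≡⟨ cong (λ l → ∑ l G) (trans (cong suc n≡) (index j m)) ⟩
      ∑ (j ℕ.+ (suc m ℕ.+ j)) G
        ≡⟨ ∑-split j (suc m ℕ.+ j) G ⟩
      ∑ j G + ∑ (suc m ℕ.+ j) (λ k → G (j ℕ.+ k))
        ≡⟨ cong₂ _+_ (∑-zero j G-low) (∑-split (suc m) j (λ k → G (j ℕ.+ k))) ⟩
      0ℤ + (∑ (suc m) (λ k → G (j ℕ.+ k)) + ∑ j (λ k → G (j ℕ.+ (suc m ℕ.+ k))))
        ≡⟨ trans (+-identityˡ _) (trans (cong (λ z → ∑ (suc m) (λ k → G (j ℕ.+ k)) + z) (∑-zero j high)) (+-identityʳ _)) ⟩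
      ∑ (suc m) (λ k → G (j ℕ.+ k))
        ≡⟨ ∑-cong (suc m) (λ { i (s≤s i≤m) → middle i i≤m }) ⟩
      ∑ (suc m) (λ i → binom n (j ℕ.+ j) * central j * (binom m i * superCatalan (j ℕ.+ i) (j ℕ.+ (m ∸ i))))
        ≡⟨ *-distribˡ-∑ (suc m) (binom n (j ℕ.+ j) * central j) _ ⟩
      binom n (j ℕ.+ j) * central j * ∑ (suc m) (λ i → binom m i * superCatalan (j ℕ.+ i) (j ℕ.+ (m ∸ i)))
        ≡⟨ cong (λ z → binom n (j ℕ.+ j) * central j * z) (∑-binom-superCatalan j m) ⟩
      binom n (j ℕ.+ j) * central j * ((+ 4) ^ m * central j) ∎
      where
      index : ∀ j m → suc ((j ℕ.+ j) ℕ.+ m) ≡ j ℕ.+ (suc m ℕ.+ j)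
      index = ℕ-solve-∀
      high : ∀ k → k ℕ.< j → G (j ℕ.+ (suc m ℕ.+ k)) ≡ 0ℤ
      high k k<j = G-high (j ℕ.+ (suc m ℕ.+ k)) (subst (ℕ._< j) (sym n∸≡) (ℕ.∸-monoʳ-< {j} {suc k} {0} (s≤s z≤n) k<j))
        where
        shift : ∀ j m k → j ℕ.+ (suc m ℕ.+ k) ≡ (j ℕ.+ m) ℕ.+ suc k
        shift = ℕ-solve-∀
        shift′ : ∀ j m → (j ℕ.+ j) ℕ.+ m ≡ (j ℕ.+ m) ℕ.+ j
        shift′ = ℕ-solve-∀
        n∸≡ : n ∸ (j ℕ.+ (suc m ℕ.+ k)) ≡ j ∸ suc k
        n∸≡ = trans (cong₂ _∸_ (trans n≡ (shift′ j m)) (shift j m k)) (ℕ.[m+n]∸[m+o]≡n∸o (j ℕ.+ m) j (suc k))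
      middle : ∀ i → i ℕ.≤ m → G (j ℕ.+ i) ≡
        binom n (j ℕ.+ j) * central j * (binom m i * superCatalan (j ℕ.+ i) (j ℕ.+ (m ∸ i)))
      middle i i≤m = begin
        G (j ℕ.+ i)
          ≡⟨ cong₂ (λ a l → superCatalan (j ℕ.+ i) l * (binom a (j ℕ.+ i) * (binom (j ℕ.+ i) j * binom l j))) n≡′ n∸≡ ⟩
        S * (binom ((j ℕ.+ i) ℕ.+ (j ℕ.+ l)) (j ℕ.+ i) * (binom (j ℕ.+ i) j * binom (j ℕ.+ l) j))
          ≡⟨ cong (λ z → S * z) (binom-regroup j i l) ⟩
        S * (binom ((j ℕ.+ j) ℕ.+ (i ℕ.+ l)) (j ℕ.+ j) * central j * binom (i ℕ.+ l) i)
          ≡⟨ cong₂ (λ a b → S * (binom a (j ℕ.+ j) * central j * binom b i))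
               (sym (trans n≡ (cong ((j ℕ.+ j) ℕ.+_) (sym i+l≡m)))) i+l≡m ⟩
        S * (binom n (j ℕ.+ j) * central j * binom m i)
          ≡⟨ lem S (binom n (j ℕ.+ j) * central j) (binom m i) ⟩
        binom n (j ℕ.+ j) * central j * (binom m i * S) ∎
        where
        l = m ∸ i
        S = superCatalan (j ℕ.+ i) (j ℕ.+ l)
        i+l≡m : i ℕ.+ l ≡ m
        i+l≡m = ℕ.m+[n∸m]≡n i≤m
        shift : ∀ j i l → (j ℕ.+ j) ℕ.+ (i ℕ.+ l) ≡ (j ℕ.+ i) ℕ.+ (j ℕ.+ l)
        shift = ℕ-solve-∀
        n≡′ : n ≡ (j ℕ.+ i) ℕ.+ (j ℕ.+ l)
        n≡′ = trans n≡ (trans (cong ((j ℕ.+ j) ℕ.+_) (sym i+l≡m)) (shift j i l))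
        n∸≡ : n ∸ (j ℕ.+ i) ≡ j ℕ.+ l
        n∸≡ = trans (cong (_∸ (j ℕ.+ i)) n≡′) (ℕ.m+n∸m≡n (j ℕ.+ i) (j ℕ.+ l))
        lem : ∀ s b c → s * (b * c) ≡ b * (c * s)
        lem = solve-∀

    -- For n < 2j the truncated exponent n ∸ 2j is harmless, since C(n+j,3j) is then zero, like the
    -- left side.
    ∑-regrouped-closed : binom (n ℕ.+ j) n * ∑ (suc n) G ≡
      cubicCoeff j * (binom (n ℕ.+ j) ((j ℕ.+ j) ℕ.+ j) * (+ 4) ^ (n ∸ (j ℕ.+ j)))
    ∑-regrouped-closed with (j ℕ.+ j) ℕ.≤? n
    ... | no j+j≰n = begin
      binom (n ℕ.+ j) n * ∑ (suc n) G  ≡⟨ cong (λ z → binom (n ℕ.+ j) n * z) (∑-regrouped-vanish (ℕ.≰⇒> j+j≰n)) ⟩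
      binom (n ℕ.+ j) n * 0ℤ           ≡⟨ *-zeroʳ (binom (n ℕ.+ j) n) ⟩
      0ℤ                               ≡⟨ sym (*-zeroʳ (cubicCoeff j)) ⟩
      cubicCoeff j * (0ℤ * (+ 4) ^ (n ∸ (j ℕ.+ j)))
        ≡⟨ cong (λ z → cubicCoeff j * (z * (+ 4) ^ (n ∸ (j ℕ.+ j))))
             (sym (n<k⇒binom≡0 (ℕ.+-monoˡ-< j (ℕ.≰⇒> j+j≰n)))) ⟩
      cubicCoeff j * (binom (n ℕ.+ j) ((j ℕ.+ j) ℕ.+ j) * (+ 4) ^ (n ∸ (j ℕ.+ j))) ∎
    ... | yes j+j≤n = begin
      binom (n ℕ.+ j) n * ∑ (suc n) G
        ≡⟨ cong (λ z → binom (n ℕ.+ j) n * z) (∑-regrouped m n≡) ⟩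
      binom (n ℕ.+ j) n * (binom n (j ℕ.+ j) * central j * ((+ 4) ^ m * central j))
        ≡⟨ l₁ (binom (n ℕ.+ j) n) (binom n (j ℕ.+ j)) (central j) ((+ 4) ^ m) ⟩
      (binom (n ℕ.+ j) n * binom n (j ℕ.+ j)) * (central j * central j * (+ 4) ^ m)
        ≡⟨ cong (λ z → z * (central j * central j * (+ 4) ^ m)) revise ⟩
      (binom (n ℕ.+ j) ((j ℕ.+ j) ℕ.+ j) * binom ((j ℕ.+ j) ℕ.+ j) (j ℕ.+ j)) * (central j * central j * (+ 4) ^ m)
        ≡⟨ l₂ (binom (n ℕ.+ j) ((j ℕ.+ j) ℕ.+ j)) (binom ((j ℕ.+ j) ℕ.+ j) (j ℕ.+ j)) (central j) ((+ 4) ^ m) ⟩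
      cubicCoeff j * (binom (n ℕ.+ j) ((j ℕ.+ j) ℕ.+ j) * (+ 4) ^ m) ∎
      where
      m = n ∸ (j ℕ.+ j)
      n≡ : n ≡ (j ℕ.+ j) ℕ.+ m
      n≡ = sym (ℕ.m+[n∸m]≡n j+j≤n)
      l₁ : ∀ a b c f → a * (b * c * (f * c)) ≡ (a * b) * (c * c * f)
      l₁ = solve-∀
      l₂ : ∀ a b c f → (a * b) * (c * c * f) ≡ c * c * b * (a * f)
      l₂ = solve-∀
      -- Both products are the multinomial coefficient of n + j = 2j + m + j; trinomial revision is
      -- used once for each order of the blocks m and j.
      revise : binom (n ℕ.+ j) n * binom n (j ℕ.+ j) ≡
               binom (n ℕ.+ j) ((j ℕ.+ j) ℕ.+ j) * binom ((j ℕ.+ j) ℕ.+ j) (j ℕ.+ j)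
      revise = begin
        binom (n ℕ.+ j) n * binom n J
          ≡⟨ cong (λ a → binom (a ℕ.+ j) a * binom a J) n≡ ⟩
        binom ((J ℕ.+ m) ℕ.+ j) (J ℕ.+ m) * binom (J ℕ.+ m) J
          ≡⟨ trinomial-revision J m j ⟩
        binom (J ℕ.+ (m ℕ.+ j)) J * binom (m ℕ.+ j) m
          ≡⟨ cong (λ z → binom (J ℕ.+ (m ℕ.+ j)) J * z) (binom-sym m j) ⟩
        binom (J ℕ.+ (m ℕ.+ j)) J * binom (m ℕ.+ j) j
          ≡⟨ cong (λ a → binom (J ℕ.+ a) J * binom a j) (ℕ.+-comm m j) ⟩
        binom (J ℕ.+ (j ℕ.+ m)) J * binom (j ℕ.+ m) j
          ≡⟨ sym (trinomial-revision J j m) ⟩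
        binom ((J ℕ.+ j) ℕ.+ m) (J ℕ.+ j) * binom (J ℕ.+ j) J
          ≡⟨ cong (λ a → binom a (J ℕ.+ j) * binom (J ℕ.+ j) J)
               (trans (shift J j m) (cong (ℕ._+ j) (sym n≡))) ⟩
        binom (n ℕ.+ j) (J ℕ.+ j) * binom (J ℕ.+ j) J ∎
        where
        J = j ℕ.+ j
        shift : ∀ a j m → (a ℕ.+ j) ℕ.+ m ≡ (a ℕ.+ m) ℕ.+ j
        shift = ℕ-solve-∀

  -- The free bound N will be p, so that all n < p share one range of j and the sums over n and j
  -- can be exchanged.
  domb-expansion : ∀ N n → n ℕ.< N →
    domb n ≡ ∑ N (λ j → cubicCoeff j * (binom (n ℕ.+ j) ((j ℕ.+ j) ℕ.+ j) * (+ 4) ^ (n ∸ (j ℕ.+ j))))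
  domb-expansion N n n<N = begin
    domb n
      ≡⟨ ∑-cong (suc n) (λ { k (s≤s k≤n) → expand k k≤n }) ⟩
    ∑ (suc n) (λ k → ∑ N (λ j → binom (n ℕ.+ j) n * regrouped n j k))
      ≡⟨ ∑-swap (suc n) N _ ⟩
    ∑ N (λ j → ∑ (suc n) (λ k → binom (n ℕ.+ j) n * regrouped n j k))
      ≡⟨ ∑-cong N (λ j _ → trans (*-distribˡ-∑ (suc n) (binom (n ℕ.+ j) n) (regrouped n j)) (∑-regrouped-closed n j)) ⟩
    ∑ N (λ j → cubicCoeff j * (binom (n ℕ.+ j) ((j ℕ.+ j) ℕ.+ j) * (+ 4) ^ (n ∸ (j ℕ.+ j)))) ∎
    where
    expand : ∀ k → k ℕ.≤ n → central k * central (n ∸ k) * binom n k * binom n k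
                             ≡ ∑ N (λ j → binom (n ℕ.+ j) n * regrouped n j k)
    expand k k≤n = begin
      central k * central l * binom n k * binom n k
        ≡⟨ cong (λ z → z * binom n k * binom n k) (sym (superCatalan-binom k l)) ⟩
      superCatalan k l * binom (k ℕ.+ l) k * binom n k * binom n k
        ≡⟨ cong (λ a → superCatalan k l * binom a k * binom n k * binom n k) k+l≡n ⟩
      superCatalan k l * binom n k * binom n k * binom n k
        -- One of the three factors C(n,k) becomes C(n,n-k): in `binom-product` the two lower
        -- indices then add up to n, and the coefficient is C(n+j,n).
        ≡⟨ cong (λ z → superCatalan k l * binom n k * binom n k * z) sym-n ⟩
      superCatalan k l * binom n k * binom n k * binom n l
        ≡⟨ l₁ (superCatalan k l) (binom n k) (binom n l) ⟩
      superCatalan k l * binom n k * (binom n k * binom n l)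
        ≡⟨ cong (λ z → superCatalan k l * binom n k * z) (sym (binom-product N k l n (ℕ.≤-<-trans k≤n n<N))) ⟩
      superCatalan k l * binom n k * ∑ N (λ j → binom k j * binom l j * binom (n ℕ.+ j) (k ℕ.+ l))
        ≡⟨ sym (*-distribˡ-∑ N (superCatalan k l * binom n k) _) ⟩
      ∑ N (λ j → superCatalan k l * binom n k * (binom k j * binom l j * binom (n ℕ.+ j) (k ℕ.+ l)))
        ≡⟨ ∑-cong N (λ j _ → trans
             (cong (λ a → superCatalan k l * binom n k * (binom k j * binom l j * binom (n ℕ.+ j) a)) k+l≡n)
             (l₂ (superCatalan k l) (binom n k) (binom k j) (binom l j) (binom (n ℕ.+ j) n))) ⟩
      ∑ N (λ j → binom (n ℕ.+ j) n * regrouped n j k) ∎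
      where
      l = n ∸ k
      k+l≡n : k ℕ.+ l ≡ n
      k+l≡n = ℕ.m+[n∸m]≡n k≤n
      sym-n : binom n k ≡ binom n l
      sym-n = subst (λ a → binom a k ≡ binom a l) k+l≡n (binom-sym k l)
      l₁ : ∀ s b c → s * b * b * c ≡ s * b * (b * c)
      l₁ = solve-∀
      l₂ : ∀ s b x y z → s * b * (x * y * z) ≡ z * (s * (b * (x * y)))
      l₂ = solve-∀

  -- Comparison with the coefficients of the statement

  open import Defs using (A)

  -- The bridge from `binom`, which satisfies Pascal's rule by computation and allows subtraction,
  -- to the library coefficient.
  binom≡C : ∀ n k → binom n k ≡ + (n C k)
  binom≡C n zero = refl
  binom≡C zero (suc k) = refl
  binom≡C (suc n) (suc k) =
    trans (cong₂ _+_ (binom≡C n k) (binom≡C n (suc k))) (cong +_ (nCk+nC[k+1]≡[n+1]C[k+1] n k))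

  central≡C : ∀ n → central n ≡ + ((2 ℕ.* n) C n)
  central≡C n = trans (binom≡C (n ℕ.+ n) n) (cong (λ m → + ((n ℕ.+ m) C n)) (sym (ℕ.+-identityʳ n)))

  cubicCoeff≡C : ∀ n → cubicCoeff n ≡ + (((2 ℕ.* n) C n) ℕ.* ((2 ℕ.* n) C n) ℕ.* ((3 ℕ.* n) C n))
  cubicCoeff≡C n = begin
    central n * central n * binom ((n ℕ.+ n) ℕ.+ n) (n ℕ.+ n)
      ≡⟨ cong (λ z → central n * central n * z) (trans (binom-sym (n ℕ.+ n) n) (binom≡C ((n ℕ.+ n) ℕ.+ n) n)) ⟩
    central n * central n * + (((n ℕ.+ n) ℕ.+ n) C n)
      ≡⟨ cong₂ (λ z m → z * z * + (m C n)) (central≡C n)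
           (trans (ℕ.+-assoc n n n) (cong (λ m → n ℕ.+ (n ℕ.+ m)) (sym (ℕ.+-identityʳ n)))) ⟩
    + c * + c * + b
      ≡⟨ cong (_* + b) (sym (pos-* c c)) ⟩
    + (c ℕ.* c) * + b
      ≡⟨ sym (pos-* (c ℕ.* c) b) ⟩
    + (c ℕ.* c ℕ.* b) ∎
    where
    c = (2 ℕ.* n) C n
    b = (3 ℕ.* n) C n

  dombTerm : ℕ → ℕ → ℕ
  dombTerm n k = ((2 ℕ.* k) C k) ℕ.* ((2 ℕ.* n ∸ 2 ℕ.* k) C (n ∸ k)) ℕ.* (n C k) ℕ.* (n C k)

  -- A n is computed by a local function of Defs that cannot be named here; this relation is
  -- specific enough for Agda to find that function by unification.
  data PartialSum (n : ℕ) : ℕ → ℕ → Set where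
    start : PartialSum n 0 (dombTerm n 0)
    next  : ∀ {m s} → PartialSum n m s → PartialSum n (suc m) (s ℕ.+ dombTerm n (suc m))

  mutual
    A-sum : ∀ n → PartialSum n n (A n)
    A-sum zero    = start
    A-sum (suc n) = next (A-sum-suc n)

    A-sum-suc : ∀ n → PartialSum (suc n) n _
    -- Replacing n + 1 by a variable separates the fixed index inside the summands from the counter
    -- on which the recursion runs.
    A-sum-suc n with suc n
    ... | k = A-sum-go k n

    A-sum-go : ∀ n m → PartialSum n m _
    A-sum-go n zero    = start
    A-sum-go n (suc m) = next (A-sum-go n m)

  dombTerm≡ : ∀ n k → + dombTerm n k ≡ central k * central (n ∸ k) * binom n k * binom n k
  dombTerm≡ n k = begin
    + (a ℕ.* b ℕ.* c ℕ.* c)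
      ≡⟨ trans (pos-* (a ℕ.* b ℕ.* c) c) (cong (_* + c) (trans (pos-* (a ℕ.* b) c) (cong (_* + c) (pos-* a b)))) ⟩
    + a * + b * + c * + c
      ≡⟨ cong₂ (λ x y → x * y * + c * + c) (sym (central≡C k))
           (trans (cong (λ m → + (m C (n ∸ k))) (sym (ℕ.*-distribˡ-∸ 2 n k))) (sym (central≡C (n ∸ k)))) ⟩
    central k * central (n ∸ k) * + c * + c
      ≡⟨ cong (λ z → central k * central (n ∸ k) * z * z) (sym (binom≡C n k)) ⟩
    central k * central (n ∸ k) * binom n k * binom n k ∎
    where
    a = (2 ℕ.* k) C k
    b = (2 ℕ.* n ∸ 2 ℕ.* k) C (n ∸ k)
    c = n C k

  A≡domb : ∀ n → + A n ≡ domb n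
  A≡domb n = partial (A-sum n)
    where
    partial : ∀ {m s} → PartialSum n m s → + s ≡ ∑ (suc m) (λ k → central k * central (n ∸ k) * binom n k * binom n k)
    partial start = trans (dombTerm≡ n 0) (sym (+-identityˡ _))
    partial (next {m} {s} h) = cong₂ _+_ (partial h) (dombTerm≡ n (suc m))

open Integral

module Congruence where

  open import Data.Integer using (_+_; _*_; _-_; -_; _^_)
  open import Data.Integer.Properties

  -- Binomial sums of powers

  ∑-binom-power : ∀ x m → ∑ (suc m) (λ i → binom m i * x ^ i) ≡ (1ℤ + x) ^ m
  ∑-binom-power x m =
    trans (∑-binom-geometric (1ℤ + x) (λ _ i → x ^ i) (λ _ i _ → lem x (x ^ i)) m) (*-identityʳ ((1ℤ + x) ^ m))
    where
    lem : ∀ x y → y + x * y ≡ (1ℤ + x) * y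
    lem = solve-∀

  -- The coefficient of x^m on the left is C(m+r+1,r+1) - C(m+r,r+1) = C(m+r,r) for m < M; the
  -- subtracted term is what the cutoff leaves at x^M.
  ∑-binom-telescope : ∀ x r M →
    (1ℤ - x) * ∑ M (λ m → binom (m ℕ.+ suc r) (suc r) * x ^ m) ≡
    ∑ M (λ m → binom (m ℕ.+ r) r * x ^ m) - binom (M ℕ.+ r) (suc r) * x ^ M
  ∑-binom-telescope x r zero = trans (*-zeroʳ (1ℤ - x))
    (sym (cong (λ z → 0ℤ - z * 1ℤ) (n<k⇒binom≡0 {r} ℕ.≤-refl)))
  ∑-binom-telescope x r (suc M) = begin
    (1ℤ - x) * (S + binom (M ℕ.+ suc r) (suc r) * x ^ M)
      ≡⟨ cong (λ n → (1ℤ - x) * (S + binom n (suc r) * x ^ M)) (ℕ.+-suc M r) ⟩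
    (1ℤ - x) * (S + (b + b′) * x ^ M)
      ≡⟨ l₁ x S b b′ (x ^ M) ⟩
    (1ℤ - x) * S + (b + b′) * x ^ M - (b + b′) * (x * x ^ M)
      ≡⟨ cong (λ z → z + (b + b′) * x ^ M - (b + b′) * (x * x ^ M)) (∑-binom-telescope x r M) ⟩
    (S′ - b′ * x ^ M) + (b + b′) * x ^ M - (b + b′) * (x * x ^ M)
      ≡⟨ l₂ x S′ b b′ (x ^ M) ⟩
    (S′ + b * x ^ M) - (b + b′) * (x * x ^ M) ∎
    where
    open ≡-Reasoning
    S = ∑ M (λ m → binom (m ℕ.+ suc r) (suc r) * x ^ m)
    S′ = ∑ M (λ m → binom (m ℕ.+ r) r * x ^ m)
    b = binom (M ℕ.+ r) r
    b′ = binom (M ℕ.+ r) (suc r)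
    l₁ : ∀ x s b c y → (1ℤ - x) * (s + (b + c) * y) ≡ (1ℤ - x) * s + (b + c) * y - (b + c) * (x * y)
    l₁ = solve-∀
    l₂ : ∀ x s b c y → (s - c * y) + (b + c) * y - (b + c) * (x * y) ≡ (s + b * y) - (b + c) * (x * y)
    l₂ = solve-∀

  -- The factor 1 is the computed value of C(m+0,0), so this sum is the case r = 0 of the truncated
  -- series below.
  ∑-geometric : ∀ x M → (1ℤ - x) * ∑ M (λ m → 1ℤ * x ^ m) ≡ 1ℤ - x ^ M
  ∑-geometric x zero = *-zeroʳ (1ℤ - x)
  ∑-geometric x (suc M) = begin
    (1ℤ - x) * (S + 1ℤ * x ^ M)          ≡⟨ l₁ x S (x ^ M) ⟩
    (1ℤ - x) * S + (x ^ M - x * x ^ M)   ≡⟨ cong (_+ (x ^ M - x * x ^ M)) (∑-geometric x M) ⟩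
    1ℤ - x ^ M + (x ^ M - x * x ^ M)     ≡⟨ l₂ (x ^ M) (x * x ^ M) ⟩
    1ℤ - x * x ^ M ∎
    where
    open ≡-Reasoning
    S = ∑ M (λ m → 1ℤ * x ^ m)
    l₁ : ∀ x s y → (1ℤ - x) * (s + 1ℤ * y) ≡ (1ℤ - x) * s + (y - x * y)
    l₁ = solve-∀
    l₂ : ∀ y z → 1ℤ - y + (y - z) ≡ 1ℤ - z
    l₂ = solve-∀

  ^-distribʳ-* : ∀ x y n → (x * y) ^ n ≡ x ^ n * y ^ n
  ^-distribʳ-* x y zero    = refl
  ^-distribʳ-* x y (suc n) = trans (cong (λ z → x * y * z) (^-distribʳ-* x y n)) (lem x y (x ^ n) (y ^ n))
    where
    lem : ∀ x y a b → x * y * (a * b) ≡ x * a * (y * b)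
    lem = solve-∀

  -- Congruences modulo p

  module Mod (p : ℕ) (pp : Prime p) where

    infix 4 _≈_
    record _≈_ (x y : ℤ) : Set where
      constructor congruent
      field p∣difference : + p ∣ x - y
    open _≈_ public

    reflexive : ∀ {x y} → x ≡ y → x ≈ y
    reflexive {x} refl = congruent (divides 0ℤ (+-inverseʳ x))

    ≈-sym : ∀ {x y} → x ≈ y → y ≈ x
    ≈-sym {x} {y} (congruent h) = congruent (subst (+ p ∣_) (lem x y) (∣m⇒∣-m h))
      where
      lem : ∀ x y → - (x - y) ≡ y - x
      lem = solve-∀

    ≈-trans : ∀ {x y z} → x ≈ y → y ≈ z → x ≈ z
    ≈-trans {x} {y} {z} (congruent h) (congruent g) = congruent (subst (+ p ∣_) (lem x y z) (∣m∣n⇒∣m+n h g))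
      where
      lem : ∀ x y z → (x - y) + (y - z) ≡ x - z
      lem = solve-∀

    ≈-setoid : Setoid _ _
    ≈-setoid = record
      { Carrier = ℤ ; _≈_ = _≈_
      ; isEquivalence = record { refl = reflexive refl ; sym = ≈-sym ; trans = ≈-trans } }

    open SetoidReasoning ≈-setoid

    ≈-+ : ∀ x y {x′ y′} → x ≈ x′ → y ≈ y′ → x + y ≈ x′ + y′
    ≈-+ x y {x′} {y′} (congruent h) (congruent g) =
      congruent (subst (+ p ∣_) (lem x y x′ y′) (∣m∣n⇒∣m+n h g))
      where
      lem : ∀ x y x′ y′ → (x - x′) + (y - y′) ≡ (x + y) - (x′ + y′)
      lem = solve-∀

    ≈-* : ∀ x y {x′ y′} → x ≈ x′ → y ≈ y′ → x * y ≈ x′ * y′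
    ≈-* x y {x′} {y′} (congruent h) (congruent g) =
      congruent (subst (+ p ∣_) (lem x y x′ y′) (∣m∣n⇒∣m+n (∣n⇒∣m*n y h) (∣n⇒∣m*n x′ g)))
      where
      lem : ∀ x y x′ y′ → y * (x - x′) + x′ * (y - y′) ≡ x * y - x′ * y′
      lem = solve-∀

    ≈-neg : ∀ {x y} → x ≈ y → - x ≈ - y
    ≈-neg {x} {y} (congruent h) = congruent (subst (+ p ∣_) (lem x y) (∣m⇒∣-m h))
      where
      lem : ∀ x y → - (x - y) ≡ - x - - y
      lem = solve-∀

    ≈-^ : ∀ x {x′} n → x ≈ x′ → x ^ n ≈ x′ ^ n
    ≈-^ x zero    h = reflexive refl
    ≈-^ x {x′} (suc n) h = ≈-* x (x ^ n) h (≈-^ x n h)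

    ∣⇒≈0 : ∀ {x} → + p ∣ x → x ≈ 0ℤ
    ∣⇒≈0 {x} h = congruent (subst (+ p ∣_) (sym (+-identityʳ x)) h)

    ≈-∑ : ∀ n {f g : ℕ → ℤ} → (∀ k → k ℕ.< n → f k ≈ g k) → ∑ n f ≈ ∑ n g
    ≈-∑ zero    h = reflexive refl
    ≈-∑ (suc n) {f} {g} h = ≈-+ (∑ n f) (f n) (≈-∑ n (λ k k<n → h k (ℕ.m<n⇒m<1+n k<n))) (h n ℕ.≤-refl)

    ≈0⇒∣ : ∀ {x} → x ≈ 0ℤ → + p ∣ x
    ≈0⇒∣ {x} (congruent h) = subst (+ p ∣_) (+-identityʳ x) h

    ∑≈0 : ∀ n {f : ℕ → ℤ} → (∀ k → k ℕ.< n → f k ≈ 0ℤ) → ∑ n f ≈ 0ℤ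
    ∑≈0 n h = ≈-trans (≈-∑ n h) (reflexive (∑-zero n (λ _ _ → refl)))

    p∤1 : ¬ + p ∣ 1ℤ
    p∤1 p∣1 = contradiction (ℕ.∣1⇒≡1 (∣⇒∣ᵤ p∣1)) (ℕ.nonTrivial⇒≢1 {{prime⇒nonTrivial pp}})

    ∤-* : ∀ {x y} → ¬ + p ∣ x → ¬ + p ∣ y → ¬ + p ∣ x * y
    ∤-* {x} {y} p∤x p∤y p∣xy
      with euclidsLemma ∣ x ∣ ∣ y ∣ pp (subst (p ℕ.∣_) (abs-* x y) (∣⇒∣ᵤ p∣xy))
    ... | inj₁ p∣x = p∤x (∣ᵤ⇒∣ p∣x)
    ... | inj₂ p∣y = p∤y (∣ᵤ⇒∣ p∣y)

    ∤-^ : ∀ {x} n → ¬ + p ∣ x → ¬ + p ∣ x ^ n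
    ∤-^ zero    p∤x = p∤1
    ∤-^ {x} (suc n) p∤x = ∤-* {x} {x ^ n} p∤x (∤-^ n p∤x)

    ∤-cancelʳ : ∀ x y → ¬ + p ∣ y → + p ∣ x * y → + p ∣ x
    ∤-cancelʳ x y p∤y p∣xy
      with euclidsLemma ∣ x ∣ ∣ y ∣ pp (subst (p ℕ.∣_) (abs-* x y) (∣⇒∣ᵤ p∣xy))
    ... | inj₁ p∣x = ∣ᵤ⇒∣ p∣x
    ... | inj₂ p∣y = contradiction (∣ᵤ⇒∣ p∣y) p∤y

    ≈-cancelˡ : ∀ t x y → ¬ + p ∣ t → t * x ≈ t * y → x ≈ y
    ≈-cancelˡ t x y p∤t (congruent h) = congruent (∤-cancelʳ (x - y) t p∤t (subst (+ p ∣_) (lem t x y) h))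
      where
      lem : ∀ t x y → t * x - t * y ≡ (x - y) * t
      lem = solve-∀

    -- Factorials and binomial coefficients modulo p

    n<p⇒p∤n! : ∀ {n} → n ℕ.< p → ¬ + p ∣ + (n !)
    n<p⇒p∤n! {zero}  _   = p∤1
    n<p⇒p∤n! {suc n} n<p p∣n! with euclidsLemma (suc n) (n !) pp (∣⇒∣ᵤ p∣n!)
    ... | inj₁ p∣1+n = ℕ.<⇒≱ n<p (ℕ.∣⇒≤ p∣1+n)
    ... | inj₂ p∣n!′ = n<p⇒p∤n! (ℕ.<-trans (ℕ.n<1+n n) n<p) (∣ᵤ⇒∣ p∣n!′)

    p≤n⇒p∣n! : ∀ {n} → p ℕ.≤ n → + p ∣ + (n !)
    p≤n⇒p∣n! {n} p≤n = ∣ᵤ⇒∣ (ℕ.∣-trans (p∣p! p {{prime⇒nonZero pp}}) (ℕ.m≤n⇒m!∣n! p≤n))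
      where
      p∣p! : ∀ q .{{_ : ℕ.NonZero q}} → q ℕ.∣ q !
      p∣p! (suc q) = ℕ.m∣m*n (q !)

    -- The prime p divides (a+b)! but neither a! nor b!, so by `binom-!` it divides the quotient.
    p∣binom : ∀ {a b} → a ℕ.< p → b ℕ.< p → p ℕ.≤ a ℕ.+ b → + p ∣ binom (a ℕ.+ b) a
    p∣binom {a} {b} a<p b<p p≤a+b = ∤-cancelʳ (binom (a ℕ.+ b) a) (+ (a !) * + (b !))
      (∤-* {+ (a !)} {+ (b !)} (n<p⇒p∤n! a<p) (n<p⇒p∤n! b<p))
      (subst (+ p ∣_) (sym (binom-! a b)) (p≤n⇒p∣n! p≤a+b))

    p∣binom′ : ∀ {n k} → k ℕ.< p → n ∸ k ℕ.< p → p ℕ.≤ n → k ℕ.≤ n → + p ∣ binom n k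
    p∣binom′ {n} {k} k<p n∸k<p p≤n k≤n = subst (λ m → + p ∣ binom m k) (ℕ.m+[n∸m]≡n k≤n)
      (p∣binom k<p n∸k<p (ℕ.≤-trans p≤n (ℕ.≤-reflexive (sym (ℕ.m+[n∸m]≡n k≤n)))))

    p∣cubicCoeff : ∀ j → j ℕ.< p → p ℕ.≤ (j ℕ.+ j) ℕ.+ j → + p ∣ cubicCoeff j
    p∣cubicCoeff j j<p p≤3j = subst (+ p ∣_) (sym (*-assoc c c b))
      (∣n⇒∣m*n c (∤-cancelʳ (c * b) (+ (j !) * + (j !) * + (j !))
        (∤-* {+ (j !) * + (j !)} {+ (j !)} (∤-* {+ (j !)} {+ (j !)} p∤j! p∤j!) p∤j!)
        (subst (+ p ∣_) product (p≤n⇒p∣n! p≤3j))))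
      where
      c = central j
      b = binom ((j ℕ.+ j) ℕ.+ j) (j ℕ.+ j)
      p∤j! = n<p⇒p∤n! j<p
      lem : ∀ c b f → b * (c * (f * f) * f) ≡ (c * b) * (f * f * f)
      lem = solve-∀
      product : + (((j ℕ.+ j) ℕ.+ j) !) ≡ (c * b) * (+ (j !) * + (j !) * + (j !))
      product = trans (sym (binom-! (j ℕ.+ j) j))
        (trans (cong (λ z → b * (z * + (j !))) (sym (binom-! j j))) (lem c b (+ (j !))))

    -- Fermat's theorem

    frobenius : ∀ x → (1ℤ + x) ^ p ≈ 1ℤ + x ^ p
    frobenius x = frob p refl {{prime⇒nonZero pp}}
      where
      frob : ∀ q → q ≡ p → .{{_ : ℕ.NonZero q}} → (1ℤ + x) ^ q ≈ 1ℤ + x ^ q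
      frob (suc q) refl = begin
        (1ℤ + x) ^ suc q
          ≡⟨ sym (∑-binom-power x (suc q)) ⟩
        ∑ (suc q) (λ i → binom (suc q) i * x ^ i) + binom (suc q) (suc q) * x ^ suc q
          ≡⟨ cong₂ _+_ (∑-head q _) (trans (cong (_* x ^ suc q) (binom-diag (suc q))) (*-identityˡ (x ^ suc q))) ⟩
        (1ℤ + ∑ q (λ i → binom (suc q) (suc i) * x ^ suc i)) + x ^ suc q
          ≈⟨ ≈-+ (1ℤ + ∑ q (λ i → binom (suc q) (suc i) * x ^ suc i)) (x ^ suc q)
               (≈-+ 1ℤ (∑ q (λ i → binom (suc q) (suc i) * x ^ suc i)) (reflexive refl) (∑≈0 q middle)) (reflexive refl) ⟩
        (1ℤ + 0ℤ) + x ^ suc q ≡⟨ refl ⟩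
        1ℤ + x ^ suc q ∎
        where
        middle : ∀ i → i ℕ.< q → binom (suc q) (suc i) * x ^ suc i ≈ 0ℤ
        middle i i<q = ∣⇒≈0 (∣m⇒∣m*n (x ^ suc i)
          (p∣binom′ (s≤s i<q) (ℕ.s≤s (ℕ.m∸n≤m q i)) ℕ.≤-refl (ℕ.<⇒≤ (s≤s i<q))))

    -- Frobenius read downwards: the induction step that reaches the negative integers from 0.
    fermat-pred : ∀ x → (1ℤ + x) ^ p ≈ 1ℤ + x → x ^ p ≈ x
    fermat-pred x h = congruent (subst (+ p ∣_) (lem (x ^ p) x) (p∣difference (≈-trans (≈-sym (frobenius x)) h)))
      where
      lem : ∀ y x → (1ℤ + y) - (1ℤ + x) ≡ y - x
      lem = solve-∀

    fermat : ∀ x → x ^ p ≈ x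
    fermat (+ zero) = reflexive (0^p p {{prime⇒nonZero pp}})
      where
      0^p : ∀ q .{{_ : ℕ.NonZero q}} → 0ℤ ^ q ≡ 0ℤ
      0^p (suc q) = refl
    fermat (+ suc n) = begin
      (1ℤ + + n) ^ p  ≈⟨ frobenius (+ n) ⟩
      1ℤ + (+ n) ^ p  ≈⟨ ≈-+ 1ℤ ((+ n) ^ p) (reflexive refl) (fermat (+ n)) ⟩
      + suc n ∎
    fermat -[1+ zero ]  = fermat-pred -[1+ zero ] (fermat (+ zero))
    fermat -[1+ suc n ] = fermat-pred -[1+ suc n ] (fermat -[1+ n ])

    -- Truncated negative binomial series modulo p

    module _ (x : ℤ) (p∤1-x : ¬ + p ∣ 1ℤ - x) where

      private
        G : ℕ → ℤ
        G r = ∑ p (λ m → binom (m ℕ.+ r) r * x ^ m)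

      -- At r = 0, (1-x) G 0 = 1 - x^p ≡ 1 - x, and 1 - x cancels; hence the exponent r and not r +
      -- 1. Each step telescopes, and its boundary term contains C(p+r,r+1), divisible by p because
      -- r + 1 < p.
      [1-x]^r*∑-binom≈1 : ∀ r → r ℕ.< p → (1ℤ - x) ^ r * G r ≈ 1ℤ
      [1-x]^r*∑-binom≈1 zero _ = ≈-trans (reflexive (*-identityˡ (G 0)))
        (≈-cancelˡ (1ℤ - x) (G 0) 1ℤ p∤1-x (begin
          (1ℤ - x) * G 0  ≡⟨ ∑-geometric x p ⟩
          1ℤ - x ^ p      ≈⟨ ≈-+ 1ℤ (- (x ^ p)) (reflexive refl) (≈-neg (fermat x)) ⟩
          1ℤ - x          ≡⟨ sym (*-identityʳ (1ℤ - x)) ⟩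
          (1ℤ - x) * 1ℤ ∎))
      [1-x]^r*∑-binom≈1 (suc r) 1+r<p = begin
        (1ℤ - x) * (1ℤ - x) ^ r * G (suc r)
          ≡⟨ lem (1ℤ - x) ((1ℤ - x) ^ r) (G (suc r)) ⟩
        (1ℤ - x) ^ r * ((1ℤ - x) * G (suc r))
          ≡⟨ cong (λ z → (1ℤ - x) ^ r * z) (∑-binom-telescope x r p) ⟩
        (1ℤ - x) ^ r * (G r - binom (p ℕ.+ r) (suc r) * x ^ p)
          ≈⟨ ≈-* ((1ℤ - x) ^ r) (G r - binom (p ℕ.+ r) (suc r) * x ^ p) (reflexive refl) drop ⟩
        (1ℤ - x) ^ r * G r
          ≈⟨ [1-x]^r*∑-binom≈1 r (ℕ.<-trans (ℕ.n<1+n r) 1+r<p) ⟩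
        1ℤ ∎
        where
        lem : ∀ t s g → t * s * g ≡ s * (t * g)
        lem = solve-∀
        lem′ : ∀ g y → - y ≡ (g - y) - g
        lem′ = solve-∀
        p+r∸[1+r]<p : ∀ q r → suc r ℕ.< q → (q ℕ.+ r) ∸ suc r ℕ.< q
        p+r∸[1+r]<p (suc q) r _ = s≤s (ℕ.≤-reflexive (ℕ.m+n∸n≡m q r))
        drop : G r - binom (p ℕ.+ r) (suc r) * x ^ p ≈ G r
        drop = congruent (subst (+ p ∣_) (lem′ (G r) (binom (p ℕ.+ r) (suc r) * x ^ p))
          (∣m⇒∣-m (∣m⇒∣m*n (x ^ p) (p∣binom′ 1+r<p (p+r∸[1+r]<p p r 1+r<p) (ℕ.m≤m+n p r)
            (ℕ.≤-trans (ℕ.<⇒≤ 1+r<p) (ℕ.m≤m+n p r))))))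

    -- The congruence for integers v and w

    module _ (v w : ℤ) (p∤1-4v : ¬ + p ∣ 1ℤ - + 4 * v)
             (w-def : w * (1ℤ - + 4 * v) ^ 3 ≈ v ^ 2) where

      private
        t = 1ℤ - + 4 * v

        F : ℕ → ℕ → ℤ
        F j n = binom (n ℕ.+ j) ((j ℕ.+ j) ℕ.+ j) * (+ 4) ^ (n ∸ (j ℕ.+ j)) * v ^ n

        -- The window n < p is moved to 2j ≤ n < p + 2j. The terms dropped below are zero; those
        -- added, n = p + i with i < 2j, contain C(p+i+j,3j), which p divides since 3j < p and p + i
        -- - 2j < p.
        ∑F-shift : ∀ j → (j ℕ.+ j) ℕ.+ j ℕ.< p →
          ∑ p (F j) ≈ v ^ (j ℕ.+ j) * ∑ p (λ m → binom (m ℕ.+ ((j ℕ.+ j) ℕ.+ j)) ((j ℕ.+ j) ℕ.+ j) * (+ 4 * v) ^ m)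
        ∑F-shift j 3j<p = begin
          ∑ p (F j)
            ≡⟨ sym (+-identityʳ _) ⟩
          ∑ p (F j) + 0ℤ
            ≈⟨ ≈-+ (∑ p (F j)) 0ℤ (reflexive refl) (≈-sym (∑≈0 J high)) ⟩
          ∑ p (F j) + ∑ J (λ i → F j (p ℕ.+ i))
            ≡⟨ sym (∑-split p J (F j)) ⟩
          ∑ (p ℕ.+ J) (F j)
            ≡⟨ cong (λ n → ∑ n (F j)) (ℕ.+-comm p J) ⟩
          ∑ (J ℕ.+ p) (F j)
            ≡⟨ ∑-split J p (F j) ⟩
          ∑ J (F j) + ∑ p (λ m → F j (J ℕ.+ m))
            ≡⟨ cong (_+ ∑ p (λ m → F j (J ℕ.+ m))) (∑-zero J low) ⟩
          0ℤ + ∑ p (λ m → F j (J ℕ.+ m))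
            ≡⟨ +-identityˡ _ ⟩
          ∑ p (λ m → F j (J ℕ.+ m))
            ≡⟨ ∑-cong p (λ m _ → shift m) ⟩
          ∑ p (λ m → v ^ J * (binom (m ℕ.+ (J ℕ.+ j)) (J ℕ.+ j) * (+ 4 * v) ^ m))
            ≡⟨ *-distribˡ-∑ p (v ^ J) _ ⟩
          v ^ J * ∑ p (λ m → binom (m ℕ.+ (J ℕ.+ j)) (J ℕ.+ j) * (+ 4 * v) ^ m) ∎
          where
          J = j ℕ.+ j
          low : ∀ k → k ℕ.< J → F j k ≡ 0ℤ
          low k k<J = cong (λ b → b * (+ 4) ^ (k ∸ J) * v ^ k) (n<k⇒binom≡0 (ℕ.+-monoˡ-< j k<J))
          high : ∀ i → i ℕ.< J → F j (p ℕ.+ i) ≈ 0ℤ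
          high i i<J = ∣⇒≈0 (∣m⇒∣m*n (v ^ (p ℕ.+ i)) (∣m⇒∣m*n ((+ 4) ^ (p ℕ.+ i ∸ J))
            (p∣binom′ 3j<p
              (subst (ℕ._< p) (sym (trans (cong₂ _∸_ (ℕ.+-comm (p ℕ.+ i) j) (ℕ.+-comm J j)) (ℕ.[m+n]∸[m+o]≡n∸o j (p ℕ.+ i) J)))
                (subst ((p ℕ.+ i) ∸ J ℕ.<_) (ℕ.m+n∸n≡m p J)
                  (ℕ.∸-monoˡ-< (ℕ.+-monoʳ-< p i<J) (ℕ.≤-trans (ℕ.≤-trans (ℕ.m≤m+n J j) (ℕ.<⇒≤ 3j<p)) (ℕ.m≤m+n p i)))))
              (ℕ.≤-trans (ℕ.m≤m+n p i) (ℕ.m≤m+n (p ℕ.+ i) j))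
              (ℕ.≤-trans (ℕ.<⇒≤ 3j<p) (ℕ.≤-trans (ℕ.m≤m+n p i) (ℕ.m≤m+n (p ℕ.+ i) j))))))
          index : ∀ J m j → (J ℕ.+ m) ℕ.+ j ≡ m ℕ.+ (J ℕ.+ j)
          index = ℕ-solve-∀
          lem : ∀ b f x y → b * f * (x * y) ≡ x * (b * (f * y))
          lem = solve-∀
          shift : ∀ m → F j (J ℕ.+ m) ≡ v ^ J * (binom (m ℕ.+ (J ℕ.+ j)) (J ℕ.+ j) * (+ 4 * v) ^ m)
          shift m = trans
              (cong₂ (λ n e → binom n (J ℕ.+ j) * (+ 4) ^ e * v ^ (J ℕ.+ m)) (index J m j) (ℕ.m+n∸m≡n J m))
              (trans (cong (λ z → B * (+ 4) ^ m * z) (^-distribˡ-+-* v J m))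
              (trans (lem B ((+ 4) ^ m) (v ^ J) (v ^ m))
                (cong (λ z → v ^ J * (B * z)) (sym (^-distribʳ-* (+ 4) v m)))))
            where
            B = binom (m ℕ.+ (J ℕ.+ j)) (J ℕ.+ j)

        -- Multiplied by the invertible t^(3j), both sides become v^(2j): the left by the truncated
        -- series, the right because w t³ ≡ v².
        ∑F≈ : ∀ j → (j ℕ.+ j) ℕ.+ j ℕ.< p → ∑ p (F j) ≈ w ^ j
        ∑F≈ j 3j<p = ≈-cancelˡ (t ^ T) (∑ p (F j)) (w ^ j) (∤-^ {t} T p∤1-4v) (begin
          t ^ T * ∑ p (F j)
            ≈⟨ ≈-* (t ^ T) (∑ p (F j)) (reflexive refl) (∑F-shift j 3j<p) ⟩
          t ^ T * (v ^ (j ℕ.+ j) * G)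
            ≡⟨ swap (t ^ T) (v ^ (j ℕ.+ j)) G ⟩
          v ^ (j ℕ.+ j) * (t ^ T * G)
            ≈⟨ ≈-* (v ^ (j ℕ.+ j)) (t ^ T * G) (reflexive refl) ([1-x]^r*∑-binom≈1 (+ 4 * v) p∤1-4v T 3j<p) ⟩
          v ^ (j ℕ.+ j) * 1ℤ
            ≡⟨ trans (*-identityʳ (v ^ (j ℕ.+ j))) (trans (cong (v ^_) (two j)) (sym (^-*-assoc v 2 j))) ⟩
          (v ^ 2) ^ j
            ≈⟨ ≈-sym (≈-^ (w * t ^ 3) j w-def) ⟩
          (w * t ^ 3) ^ j
            ≡⟨ ^-distribʳ-* w (t ^ 3) j ⟩
          w ^ j * (t ^ 3) ^ j
            ≡⟨ trans (*-comm (w ^ j) _) (cong (_* w ^ j) (trans (^-*-assoc t 3 j) (cong (t ^_) (sym (three j))))) ⟩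
          t ^ T * w ^ j ∎)
          where
          T = (j ℕ.+ j) ℕ.+ j
          G = ∑ p (λ m → binom (m ℕ.+ T) T * (+ 4 * v) ^ m)
          two : ∀ j → j ℕ.+ j ≡ 2 ℕ.* j
          two = ℕ-solve-∀
          three : ∀ j → (j ℕ.+ j) ℕ.+ j ≡ 3 ℕ.* j
          three = ℕ-solve-∀
          swap : ∀ a b c → a * (b * c) ≡ b * (a * c)
          swap = solve-∀

      ∑-domb≈ : ∑ p (λ n → domb n * v ^ n) ≈ ∑ p (λ j → cubicCoeff j * w ^ j)
      ∑-domb≈ = begin
        ∑ p (λ n → domb n * v ^ n)
          ≡⟨ ∑-cong p (λ n n<p → trans (cong (_* v ^ n) (domb-expansion p n n<p)) (distribute n)) ⟩
        ∑ p (λ n → ∑ p (λ j → cubicCoeff j * F j n))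
          ≡⟨ ∑-swap p p (λ n j → cubicCoeff j * F j n) ⟩
        ∑ p (λ j → ∑ p (λ n → cubicCoeff j * F j n))
          ≡⟨ ∑-cong p (λ j _ → *-distribˡ-∑ p (cubicCoeff j) (F j)) ⟩
        ∑ p (λ j → cubicCoeff j * ∑ p (F j))
          ≈⟨ ≈-∑ p column ⟩
        ∑ p (λ j → cubicCoeff j * w ^ j) ∎
        where
        f : ℕ → ℕ → ℤ
        f n j = cubicCoeff j * (binom (n ℕ.+ j) ((j ℕ.+ j) ℕ.+ j) * (+ 4) ^ (n ∸ (j ℕ.+ j)))
        lem : ∀ y c b → y * (c * b) ≡ c * (b * y)
        lem = solve-∀
        distribute : ∀ n → ∑ p (f n) * v ^ n ≡ ∑ p (λ j → cubicCoeff j * F j n)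
        distribute n = trans (*-comm (∑ p (f n)) (v ^ n)) (trans (sym (*-distribˡ-∑ p (v ^ n) (f n)))
          (∑-cong p (λ j _ → lem (v ^ n) (cubicCoeff j) (binom (n ℕ.+ j) ((j ℕ.+ j) ℕ.+ j) * (+ 4) ^ (n ∸ (j ℕ.+ j))))))
        column : ∀ j → j ℕ.< p → cubicCoeff j * ∑ p (F j) ≈ cubicCoeff j * w ^ j
        column j j<p with p ℕ.≤? (j ℕ.+ j) ℕ.+ j
        ... | no  p≰3j = ≈-* (cubicCoeff j) (∑ p (F j)) (reflexive refl) (∑F≈ j (ℕ.≰⇒> p≰3j))
        ... | yes p≤3j = ≈-trans (∣⇒≈0 (∣m⇒∣m*n (∑ p (F j)) (p∣cubicCoeff j j<p p≤3j)))
                           (≈-sym (∣⇒≈0 (∣m⇒∣m*n (w ^ j) (p∣cubicCoeff j j<p p≤3j))))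

open Congruence

-- Integers inside the rationals

import Data.Integer.Properties as ℤ
import Data.Rational.Properties as ℚ
import Data.Rational.Unnormalised as ℚᵘ
import Data.Rational.Unnormalised.Properties as ℚᵘ
open import Data.Rational.Solver using (module +-*-Solver)
open +-*-Solver using (solve; _:=_; _:+_; _:*_)
open import Defs
open import Data.Rational as ℚ using (ℚ; 1ℚ; _+_; _*_; _-_; -_; mkℚ; ↥_; ↧_; toℚᵘ; fromℚᵘ)

-- Built like `ℕ→ℚ`, so that the two agree on natural numbers by computation.
fromℤ : ℤ → ℚ
fromℤ i = fromℚᵘ (ℚᵘ.mkℚᵘ i 0)

toℚᵘ-fromℤ : ∀ i → toℚᵘ (fromℤ i) ℚᵘ.≃ ℚᵘ.mkℚᵘ i 0
toℚᵘ-fromℤ i = ℚ.toℚᵘ-fromℚᵘ (ℚᵘ.mkℚᵘ i 0)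

fromℤ-* : ∀ i j → fromℤ (i ℤ.* j) ≡ fromℤ i * fromℤ j
fromℤ-* i j = ℚ.toℚᵘ-injective (begin
  toℚᵘ (fromℤ (i ℤ.* j))                ≈⟨ toℚᵘ-fromℤ (i ℤ.* j) ⟩
  ℚᵘ.mkℚᵘ i 0 ℚᵘ.* ℚᵘ.mkℚᵘ j 0          ≈⟨ ℚᵘ.≃-sym (ℚᵘ.*-cong (toℚᵘ-fromℤ i) (toℚᵘ-fromℤ j)) ⟩
  toℚᵘ (fromℤ i) ℚᵘ.* toℚᵘ (fromℤ j)    ≈⟨ ℚᵘ.≃-sym (ℚ.toℚᵘ-homo-* (fromℤ i) (fromℤ j)) ⟩
  toℚᵘ (fromℤ i * fromℤ j) ∎)
  where open SetoidReasoning ℚᵘ.≃-setoid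

fromℤ-+ : ∀ i j → fromℤ (i ℤ.+ j) ≡ fromℤ i + fromℤ j
fromℤ-+ i j = ℚ.toℚᵘ-injective (begin
  toℚᵘ (fromℤ (i ℤ.+ j))                ≈⟨ toℚᵘ-fromℤ (i ℤ.+ j) ⟩
  ℚᵘ.mkℚᵘ (i ℤ.+ j) 0                   ≈⟨ ℚᵘ.*≡* (lem i j) ⟩
  ℚᵘ.mkℚᵘ i 0 ℚᵘ.+ ℚᵘ.mkℚᵘ j 0          ≈⟨ ℚᵘ.≃-sym (ℚᵘ.+-cong (toℚᵘ-fromℤ i) (toℚᵘ-fromℤ j)) ⟩
  toℚᵘ (fromℤ i) ℚᵘ.+ toℚᵘ (fromℤ j)    ≈⟨ ℚᵘ.≃-sym (ℚ.toℚᵘ-homo-+ (fromℤ i) (fromℤ j)) ⟩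
  toℚᵘ (fromℤ i + fromℤ j) ∎)
  where
  open SetoidReasoning ℚᵘ.≃-setoid
  lem : ∀ i j → (i ℤ.+ j) ℤ.* 1ℤ ≡ (i ℤ.* 1ℤ ℤ.+ j ℤ.* 1ℤ) ℤ.* 1ℤ
  lem = solve-∀

fromℤ-neg : ∀ i → fromℤ (ℤ.- i) ≡ - fromℤ i
fromℤ-neg i = ℚ.toℚᵘ-injective (begin
  toℚᵘ (fromℤ (ℤ.- i))    ≈⟨ toℚᵘ-fromℤ (ℤ.- i) ⟩
  ℚᵘ.- ℚᵘ.mkℚᵘ i 0        ≈⟨ ℚᵘ.≃-sym (ℚᵘ.-‿cong (toℚᵘ-fromℤ i)) ⟩
  ℚᵘ.- toℚᵘ (fromℤ i)     ≈⟨ ℚᵘ.≃-sym (ℚ.toℚᵘ-homo‿- (fromℤ i)) ⟩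
  toℚᵘ (- fromℤ i) ∎)
  where open SetoidReasoning ℚᵘ.≃-setoid

cross-multiply : ∀ x d e → x * fromℤ d ≡ fromℤ e → ↥ x ℤ.* d ≡ e ℤ.* ↧ x
cross-multiply x@record{} d e h with ℚᵘ.≃-trans (ℚᵘ.≃-trans (ℚᵘ.*-congˡ {toℚᵘ x} (ℚᵘ.≃-sym (toℚᵘ-fromℤ d)))
   (ℚᵘ.≃-sym (ℚ.toℚᵘ-homo-* x (fromℤ d)))) (ℚᵘ.≃-trans (ℚ.toℚᵘ-cong h) (toℚᵘ-fromℤ e))
... | ℚᵘ.*≡* eq = trans (sym (ℤ.*-identityʳ _)) (trans eq (cong (e ℤ.*_) (ℤ.*-identityʳ (↧ x))))

x*↧x≡↥x : ∀ x → x * fromℤ (↧ x) ≡ fromℤ (↥ x)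
x*↧x≡↥x x@record{} = ℚ.toℚᵘ-injective (begin
  toℚᵘ (x * fromℤ (↧ x))              ≈⟨ ℚ.toℚᵘ-homo-* x (fromℤ (↧ x)) ⟩
  toℚᵘ x ℚᵘ.* toℚᵘ (fromℤ (↧ x))      ≈⟨ ℚᵘ.*-congˡ {toℚᵘ x} (toℚᵘ-fromℤ (↧ x)) ⟩
  toℚᵘ x ℚᵘ.* ℚᵘ.mkℚᵘ (↧ x) 0         ≈⟨ ℚᵘ.*≡* (lem (↥ x) (↧ x)) ⟩
  ℚᵘ.mkℚᵘ (↥ x) 0                     ≈⟨ ℚᵘ.≃-sym (toℚᵘ-fromℤ (↥ x)) ⟩
  toℚᵘ (fromℤ (↥ x)) ∎)
  where
  open SetoidReasoning ℚᵘ.≃-setoid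
  lem : ∀ n d → (n ℤ.* d) ℤ.* 1ℤ ≡ n ℤ.* (d ℤ.* 1ℤ)
  lem = solve-∀

÷′-cancel : ∀ x y → ¬ y ≡ ℚ.0ℚ → (x ÷′ y) * y ≡ x
÷′-cancel x y y≢0 with y ℚ.≟ ℚ.0ℚ
... | yes y≡0 = contradiction y≡0 y≢0
... | no  y≢0′ = trans (ℚ.*-assoc x (ℚ.1/ y) y) (trans (cong (x *_) (ℚ.*-inverseˡ y)) (ℚ.*-identityʳ x))
  where instance _ = ℚ.≢-nonZero y≢0′

-- Reduction of ℤ_p modulo p

module Reduction (p : ℕ) (pp : Prime p) where
  open Mod p pp
  open SetoidReasoning ≈-setoid

  -- x ↦ n says that x lies in ℤ_p and is congruent to the integer n modulo p.
  record _↦_ (x : ℚ) (n : ℤ) : Set where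
    constructor reduces
    field
      den num  : ℤ
      p∤den    : ¬ + p ∣ den
      x*den    : x * fromℤ den ≡ fromℤ num
      num≈     : num ≈ n ℤ.* den

  fromℤ-↦ : ∀ n → fromℤ n ↦ n
  fromℤ-↦ n = reduces 1ℤ n p∤1 (ℚ.*-identityʳ (fromℤ n)) (reflexive (sym (ℤ.*-identityʳ n)))

  +-↦ : ∀ {x y a b} → x ↦ a → y ↦ b → (x + y) ↦ (a ℤ.+ b)
  +-↦ {x} {y} {a} {b} (reduces d e p∤d xd e≈) (reduces d′ e′ p∤d′ yd′ e′≈) =
    reduces (d ℤ.* d′) (e ℤ.* d′ ℤ.+ e′ ℤ.* d) (∤-* {d} {d′} p∤d p∤d′) eq (begin
      e ℤ.* d′ ℤ.+ e′ ℤ.* d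
        ≈⟨ ≈-+ (e ℤ.* d′) (e′ ℤ.* d) (≈-* e d′ e≈ (reflexive refl)) (≈-* e′ d e′≈ (reflexive refl)) ⟩
      a ℤ.* d ℤ.* d′ ℤ.+ b ℤ.* d′ ℤ.* d
        ≡⟨ lem a b d d′ ⟩
      (a ℤ.+ b) ℤ.* (d ℤ.* d′) ∎)
    where
    lem : ∀ a b d f → a ℤ.* d ℤ.* f ℤ.+ b ℤ.* f ℤ.* d ≡ (a ℤ.+ b) ℤ.* (d ℤ.* f)
    lem = solve-∀
    eq : (x + y) * fromℤ (d ℤ.* d′) ≡ fromℤ (e ℤ.* d′ ℤ.+ e′ ℤ.* d)
    eq = trans (cong ((x + y) *_) (fromℤ-* d d′)) (trans
      (solve 4 (λ x y d f → (x :+ y) :* (d :* f) := (x :* d) :* f :+ (y :* f) :* d) refl x y (fromℤ d) (fromℤ d′))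
      (trans (cong₂ (λ m n → m * fromℤ d′ + n * fromℤ d) xd yd′)
      (sym (trans (fromℤ-+ (e ℤ.* d′) (e′ ℤ.* d)) (cong₂ _+_ (fromℤ-* e d′) (fromℤ-* e′ d))))))

  *-↦ : ∀ {x y a b} → x ↦ a → y ↦ b → (x * y) ↦ (a ℤ.* b)
  *-↦ {x} {y} {a} {b} (reduces d e p∤d xd e≈) (reduces d′ e′ p∤d′ yd′ e′≈) =
    reduces (d ℤ.* d′) (e ℤ.* e′) (∤-* {d} {d′} p∤d p∤d′) eq
      (≈-trans (≈-* e e′ e≈ e′≈) (reflexive (lem a b d d′)))
    where
    lem : ∀ a b d f → a ℤ.* d ℤ.* (b ℤ.* f) ≡ a ℤ.* b ℤ.* (d ℤ.* f)
    lem = solve-∀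
    eq : (x * y) * fromℤ (d ℤ.* d′) ≡ fromℤ (e ℤ.* e′)
    eq = trans (cong ((x * y) *_) (fromℤ-* d d′)) (trans
      (solve 4 (λ x y d f → (x :* y) :* (d :* f) := (x :* d) :* (y :* f)) refl x y (fromℤ d) (fromℤ d′))
      (trans (cong₂ _*_ xd yd′) (sym (fromℤ-* e e′))))

  neg-↦ : ∀ {x a} → x ↦ a → (- x) ↦ (ℤ.- a)
  neg-↦ {x} {a} (reduces d e p∤d xd e≈) = reduces d (ℤ.- e) p∤d
    (trans (sym (ℚ.neg-distribˡ-* x (fromℤ d))) (trans (cong -_ xd) (sym (fromℤ-neg e))))
    (≈-trans (≈-neg e≈) (reflexive (ℤ.neg-distribˡ-* a d)))

  ^-↦ : ∀ {x a} n → x ↦ a → (x ^ n) ↦ (a ℤ.^ n)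
  ^-↦ zero    h = fromℤ-↦ 1ℤ
  ^-↦ (suc n) h = *-↦ h (^-↦ n h)

  -- `sumTo n` includes the index n, while `∑ n` stops before it.
  sumTo-↦ : ∀ n {f g} → (∀ k → f k ↦ g k) → sumTo n f ↦ ∑ (suc n) g
  sumTo-↦ zero    {f} {g} h = subst (f 0 ↦_) (sym (ℤ.+-identityˡ (g 0))) (h 0)
  sumTo-↦ (suc n) h = +-↦ (sumTo-↦ n h) (h (suc n))

  -- If p divided the reduced denominator, cross-multiplication with a denominator prime to p would
  -- make it divide the numerator too, against lowest terms.
  ↦⇒InZ : ∀ {x a} → x ↦ a → InZ p x
  ↦⇒InZ {x@(mkℚ n d-1 coprime)} (reduces d e p∤d xd _) p∣↧x = contradiction
    (recompute coprime (∣⇒∣ᵤ p∣↥x , p∣↧x)) (ℕ.nonTrivial⇒≢1 {{prime⇒nonTrivial pp}})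
    where
    p∣↥x : + p ∣ ↥ x
    p∣↥x = ∤-cancelʳ (↥ x) d p∤d (subst (+ p ∣_) (sym (cross-multiply x d e xd)) (∣n⇒∣m*n e (∣ᵤ⇒∣ p∣↧x)))

  ↦0⇒p∣↥ : ∀ {x a} → x ↦ a → a ≈ 0ℤ → + p ∣ ↥ x
  ↦0⇒p∣↥ {x} {a} (reduces d e p∤d xd e≈) a≈0 = ∤-cancelʳ (↥ x) d p∤d
    (subst (+ p ∣_) (sym (cross-multiply x d e xd)) (∣m⇒∣m*n (↧ x)
      (≈0⇒∣ (≈-trans e≈ (≈-* a d a≈0 (reflexive refl))))))

  ↦⇒CongMod : ∀ x y {a b} → x ↦ a → y ↦ b → a ≈ b → CongMod p x y
  ↦⇒CongMod _ _ h g a≈b = ↦⇒InZ h , ↦⇒InZ g ,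
    ∣⇒∣ᵤ (↦0⇒p∣↥ (+-↦ h (neg-↦ g)) (∣⇒≈0 (p∣difference a≈b)))

  -- The witness d^(p-2) comes from Fermat: d · d^(p-1) = d^p ≡ d · 1, and one d cancels.
  inverse : ∀ d → ¬ + p ∣ d → ∃ λ y → d ℤ.* y ≈ 1ℤ
  inverse d p∤d = d ℤ.^ (p ∸ 2) , ≈-cancelˡ d (d ℤ.* d ℤ.^ (p ∸ 2)) 1ℤ p∤d (begin
    d ℤ.^ suc (suc (p ∸ 2))   ≡⟨ cong (d ℤ.^_) (ℕ.m+[n∸m]≡n (ℕ.nonTrivial⇒n>1 p {{prime⇒nonTrivial pp}})) ⟩
    d ℤ.^ p                   ≈⟨ fermat d ⟩
    d                         ≡⟨ sym (ℤ.*-identityʳ d) ⟩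
    d ℤ.* 1ℤ ∎)

  InZ⇒↦ : ∀ x → InZ p x → ∃ λ a → x ↦ a
  InZ⇒↦ x p∤↧x with inverse (↧ x) (λ p∣↧x → p∤↧x (∣⇒∣ᵤ p∣↧x))
  ... | y , ↧x*y≈1 = ↥ x ℤ.* y , reduces (↧ x) (↥ x) (λ p∣↧x → p∤↧x (∣⇒∣ᵤ p∣↧x)) (x*↧x≡↥x x) (begin
    ↥ x                       ≡⟨ sym (ℤ.*-identityʳ (↥ x)) ⟩
    ↥ x ℤ.* 1ℤ                ≈⟨ ≈-* (↥ x) 1ℤ (reflexive refl) (≈-sym ↧x*y≈1) ⟩
    ↥ x ℤ.* (↧ x ℤ.* y)       ≡⟨ lem (↥ x) (↧ x) y ⟩
    ↥ x ℤ.* y ℤ.* ↧ x ∎)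
    where
    lem : ∀ a b c → a ℤ.* (b ℤ.* c) ≡ a ℤ.* c ℤ.* b
    lem = solve-∀

  -- Since p divides neither b nor d′, it does not divide e′ ≡ b d′. So y is nonzero, `÷′` is true
  -- division rather than its default 0, and e′ d is an admissible denominator.
  ÷′-↦ : ∀ {x y a b} c → x ↦ a → y ↦ b → ¬ + p ∣ b → c ℤ.* b ≈ a → (x ÷′ y) ↦ c
  ÷′-↦ {x} {y} {a} {b} c (reduces d e p∤d xd e≈) (reduces d′ e′ p∤d′ yd′ e′≈) p∤b cb≈a =
    reduces (e′ ℤ.* d) (e ℤ.* d′) (∤-* {e′} {d} p∤e′ p∤d) eq (begin
      e ℤ.* d′              ≈⟨ ≈-* e d′ e≈ (reflexive refl) ⟩
      a ℤ.* d ℤ.* d′        ≡⟨ ℤ.*-assoc a d d′ ⟩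
      a ℤ.* (d ℤ.* d′)      ≈⟨ ≈-* a (d ℤ.* d′) (≈-sym cb≈a) (reflexive refl) ⟩
      c ℤ.* b ℤ.* (d ℤ.* d′) ≡⟨ lem c b d d′ ⟩
      c ℤ.* (b ℤ.* d′ ℤ.* d) ≈⟨ ≈-* c (b ℤ.* d′ ℤ.* d) (reflexive refl) (≈-* (b ℤ.* d′) d (≈-sym e′≈) (reflexive refl)) ⟩
      c ℤ.* (e′ ℤ.* d) ∎)
    where
    lem : ∀ c b d f → c ℤ.* b ℤ.* (d ℤ.* f) ≡ c ℤ.* (b ℤ.* f ℤ.* d)
    lem = solve-∀
    p∤e′ : ¬ + p ∣ e′
    p∤e′ p∣e′ = ∤-* {b} {d′} p∤b p∤d′ (≈0⇒∣ (≈-trans (≈-sym e′≈) (∣⇒≈0 p∣e′)))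
    y≢0 : ¬ y ≡ ℚ.0ℚ
    y≢0 refl = p∤e′ (divides 0ℤ (trans (sym (ℤ.*-identityʳ e′)) (sym (cross-multiply y d′ e′ yd′))))
    q = x ÷′ y
    eq : q * fromℤ (e′ ℤ.* d) ≡ fromℤ (e ℤ.* d′)
    eq = trans (cong (q *_) (trans (fromℤ-* e′ d) (cong (_* fromℤ d) (sym yd′)))) (trans
      (solve 4 (λ q y f d → q :* ((y :* f) :* d) := ((q :* y) :* d) :* f) refl q y (fromℤ d′) (fromℤ d)) (trans
      (cong (λ z → z * fromℤ d * fromℤ d′) (÷′-cancel x y y≢0))
      (trans (cong (_* fromℤ d′) xd) (sym (fromℤ-* e d′)))))

theorem3p1 : (p : ℕ) → Prime p → ¬ (p ≡ 2) → (u : ℚ) → InZ p u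
    → ¬ CongMod p u (ℕ→ℚ 1 ÷′ ℕ→ℚ 4)
    → CongMod p (sumTo (p ∸ 1) (λ n → ℕ→ℚ (A n) * (u ^ n)))
    (sumTo (p ∸ 1) (λ k → ℕ→ℚ (((2 ℕ.* k) C k) ℕ.* ((2 ℕ.* k) C k) ℕ.* ((3 ℕ.* k) C k))
    * (((u ^ 2) ÷′ ((1ℚ - ℕ→ℚ 4 * u) ^ 3)) ^ k)))
theorem3p1 p pp p≢2 u u∈ℤₚ u≢¼ = conclude (InZ⇒↦ u u∈ℤₚ)
  where
  open Mod p pp
  open Reduction p pp

  b : ℕ → ℕ
  b k = ((2 ℕ.* k) C k) ℕ.* ((2 ℕ.* k) C k) ℕ.* ((3 ℕ.* k) C k)

  lhs rhs : ℚ
  lhs = sumTo (p ∸ 1) (λ n → ℕ→ℚ (A n) * (u ^ n))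
  rhs = sumTo (p ∸ 1) (λ k → ℕ→ℚ (b k) * (((u ^ 2) ÷′ ((1ℚ - ℕ→ℚ 4 * u) ^ 3)) ^ k))

  -- Oddness of p enters here: it puts 1/4 into ℤ_p.
  p∤4 : ¬ + p ∣ + 4
  p∤4 = ∤-* {+ 2} {+ 2} p∤2 p∤2
    where
    p∤2 : ¬ + p ∣ + 2
    p∤2 p∣2 = p≢2 (ℕ.≤-antisym (ℕ.∣⇒≤ (∣⇒∣ᵤ p∣2)) (ℕ.nonTrivial⇒n>1 p {{prime⇒nonTrivial pp}}))

  conclude : (∃ λ v → u ↦ v) → CongMod p lhs rhs
  conclude (v , u↦v) = fromInverse (inverse (t ℤ.^ 3) p∤t³)
    where
    t = 1ℤ ℤ.- + 4 ℤ.* v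

    -- If p divided 1 - 4v, then v would be a residue of 1/4 as well as of u, contrary to u ≢ 1/4.
    p∤t : ¬ + p ∣ t
    p∤t p∣t = u≢¼ (↦⇒CongMod u (ℕ→ℚ 1 ÷′ ℕ→ℚ 4) u↦v (÷′-↦ v (fromℤ-↦ 1ℤ) (fromℤ-↦ (+ 4)) p∤4 v*4≈1) (reflexive refl))
      where
      lem : ∀ v → ℤ.- (1ℤ ℤ.- + 4 ℤ.* v) ≡ v ℤ.* + 4 ℤ.- 1ℤ
      lem = solve-∀
      v*4≈1 : v ℤ.* + 4 ≈ 1ℤ
      v*4≈1 = congruent (subst (+ p ∣_) (lem v) (∣m⇒∣-m p∣t))

    p∤t³ : ¬ + p ∣ t ℤ.^ 3
    p∤t³ = ∤-^ {t} 3 p∤t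

    fromInverse : (∃ λ y → t ℤ.^ 3 ℤ.* y ≈ 1ℤ) → CongMod p lhs rhs
    fromInverse (y , t³*y≈1) = ↦⇒CongMod lhs rhs
      (sumTo-↦ (p ∸ 1) λ n → *-↦ (subst (ℕ→ℚ (A n) ↦_) (A≡domb n) (fromℤ-↦ (+ A n))) (^-↦ n u↦v))
      (sumTo-↦ (p ∸ 1) λ k → *-↦ (subst (ℕ→ℚ (b k) ↦_) (sym (cubicCoeff≡C k)) (fromℤ-↦ (+ b k)))
        (^-↦ k (÷′-↦ w (^-↦ 2 u↦v)
          (^-↦ 3 (+-↦ (fromℤ-↦ 1ℤ) (neg-↦ (*-↦ (fromℤ-↦ (+ 4)) u↦v)))) p∤t³ w-def)))
      -- The sums up to p - 1 have 1 + (p ∸ 1) terms, which is p because p ≥ 1.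
      (subst (λ m → ∑ m (λ n → domb n ℤ.* v ℤ.^ n) ≈ ∑ m (λ k → cubicCoeff k ℤ.* w ℤ.^ k))
        (sym (ℕ.m+[n∸m]≡n (ℕ.<⇒≤ (ℕ.nonTrivial⇒n>1 p {{prime⇒nonTrivial pp}}))))
        (∑-domb≈ v w p∤t w-def))
      where
      -- An integer residue of u² / (1-4u)³, with y inverse to t³ modulo p.
      w = v ℤ.^ 2 ℤ.* y
      lem : ∀ a y c → a ℤ.* y ℤ.* c ≡ a ℤ.* (c ℤ.* y)
      lem = solve-∀
      w-def : w ℤ.* t ℤ.^ 3 ≈ v ℤ.^ 2
      w-def = ≈-trans (reflexive (lem (v ℤ.^ 2) y (t ℤ.^ 3)))
        (≈-trans (≈-* (v ℤ.^ 2) (t ℤ.^ 3 ℤ.* y) (reflexive refl) t³*y≈1) (reflexive (ℤ.*-identityʳ (v ℤ.^ 2))))
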